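{- Let $\alpha,\beta,c\in\mathbb{R}$ with $\beta<0$ and $c\neq 0$, and let $\{P_m(s)\}_{m=0}^{\infty}$ be the sequence of polynomials generated by $$\sum_{m=0}^{\infty}\frac{P_m(s)}{m!}z^m=e^{czs+\alpha z^2+\beta z^4}\qquad (s,z\in\mathbb{C}).$$ Then for every $m\ge 0$, every complex zero of $P_m$ is either real or purely imaginary.
   Context: The generating relation means that $P_m(s)/m!$ is the coefficient of $z^m$ in the power series expansion in $z$ of $e^{czs+\alpha z^2+\beta z^4}$; each $P_m$ is a polynomial in $s$. -}

module Defs where

open import Data.List using (List; []; _∷_)
open import Data.Nat as ℕ using (ℕ; zero; suc; _∸_; _⊔_; _!)
import Data.Nat.Properties as ℕₚ
open import Data.Integer using (+_)
open import Data.Product using (∃; _×_; _,_; proj₁; proj₂)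
open import Data.Rational as ℚ using (ℚ; 0ℚ; 1ℚ; ½; ∣_∣; _/_; 1/_; positive; nonNegative)
import Data.Rational.Properties as ℚₚ
open import Data.Rational.Solver using (module +-*-Solver)
open import Relation.Binary.PropositionalEquality using (_≡_; refl; sym; trans; cong; subst)

-- ℝ is Cantor's completion of ℚ; without quotients, equality of reals is the
-- equivalence relation _≈ᵣ_ (the difference tends to 0).

IsCauchy : (ℕ → ℚ) → Set
IsCauchy x = ∀ ε → 0ℚ ℚ.< ε →
  ∃ λ N → ∀ m n → N ℕ.≤ m → N ℕ.≤ n → ∣ x m ℚ.- x n ∣ ℚ.< ε

record ℝ : Set where
  constructor mkℝ
  field
    seq    : ℕ → ℚ
    cauchy : IsCauchy seq
open ℝ public

infix 4 _≈ᵣ_ _<ᵣ_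

record _≈ᵣ_ (x y : ℝ) : Set where
  constructor mk≈ᵣ
  field
    close : ∀ ε → 0ℚ ℚ.< ε →
      ∃ λ N → ∀ n → N ℕ.≤ n → ∣ seq x n ℚ.- seq y n ∣ ℚ.< ε
open _≈ᵣ_ public

_<ᵣ_ : ℝ → ℝ → Set
x <ᵣ y = ∃ λ ε → 0ℚ ℚ.< ε ×
  (∃ λ N → ∀ n → N ℕ.≤ n → seq x n ℚ.+ ε ℚ.< seq y n)

private
  ∣p-p∣≡0 : ∀ p → ∣ p ℚ.- p ∣ ≡ 0ℚ
  ∣p-p∣≡0 p = cong ∣_∣ (ℚₚ.+-inverseʳ p)

  0<½ε : ∀ {ε} → 0ℚ ℚ.< ε → 0ℚ ℚ.< ½ ℚ.* ε
  0<½ε {ε} 0<ε = ℚₚ.positive⁻¹ (½ ℚ.* ε) {{ℚₚ.pos*pos⇒pos ½ ε {{positive 0<ε}}}}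

  ½ε+½ε : ∀ ε → ½ ℚ.* ε ℚ.+ ½ ℚ.* ε ≡ ε
  ½ε+½ε ε = trans (sym (ℚₚ.*-distribʳ-+ ε ½ ½)) (ℚₚ.*-identityˡ ε)

  const-cauchy : ∀ q → IsCauchy (λ _ → q)
  const-cauchy q ε 0<ε = 0 , λ _ _ _ _ → subst (ℚ._< ε) (sym (∣p-p∣≡0 q)) 0<ε

  +-cauchy : ∀ {x y} → IsCauchy x → IsCauchy y → IsCauchy (λ n → x n ℚ.+ y n)
  +-cauchy {x} {y} cx cy ε 0<ε = M ⊔ N , bound
    where
    M = proj₁ (cx (½ ℚ.* ε) (0<½ε 0<ε))
    N = proj₁ (cy (½ ℚ.* ε) (0<½ε 0<ε))
    regroup : ∀ a b c d → (a ℚ.+ b) ℚ.- (c ℚ.+ d) ≡ (a ℚ.- c) ℚ.+ (b ℚ.- d)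
    regroup = solve 4 (λ a b c d → (a :+ b) :- (c :+ d) := (a :- c) :+ (b :- d)) refl
      where open +-*-Solver
    bound : ∀ m n → M ⊔ N ℕ.≤ m → M ⊔ N ℕ.≤ n →
            ∣ (x m ℚ.+ y m) ℚ.- (x n ℚ.+ y n) ∣ ℚ.< ε
    bound m n p q = begin-strict
      ∣ (x m ℚ.+ y m) ℚ.- (x n ℚ.+ y n) ∣     ≡⟨ cong ∣_∣ (regroup (x m) (y m) (x n) (y n)) ⟩
      ∣ (x m ℚ.- x n) ℚ.+ (y m ℚ.- y n) ∣     ≤⟨ ℚₚ.∣p+q∣≤∣p∣+∣q∣ (x m ℚ.- x n) (y m ℚ.- y n) ⟩
      ∣ x m ℚ.- x n ∣ ℚ.+ ∣ y m ℚ.- y n ∣     <⟨ ℚₚ.+-mono-<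
                                                   (proj₂ (cx (½ ℚ.* ε) (0<½ε 0<ε)) m n (ℕₚ.m⊔n≤o⇒m≤o M N p) (ℕₚ.m⊔n≤o⇒m≤o M N q))
                                                   (proj₂ (cy (½ ℚ.* ε) (0<½ε 0<ε)) m n (ℕₚ.m⊔n≤o⇒n≤o M N p) (ℕₚ.m⊔n≤o⇒n≤o M N q)) ⟩
      ½ ℚ.* ε ℚ.+ ½ ℚ.* ε                     ≡⟨ ½ε+½ε ε ⟩
      ε ∎
      where open ℚₚ.≤-Reasoning

  neg-cauchy : ∀ {x} → IsCauchy x → IsCauchy (λ n → ℚ.- x n)
  neg-cauchy {x} cx ε 0<ε = proj₁ (cx ε 0<ε) , λ m n p q →
    subst (ℚ._< ε) (sym (flip m n)) (proj₂ (cx ε 0<ε) m n p q)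
    where
    flip : ∀ m n → ∣ (ℚ.- x m) ℚ.- (ℚ.- x n) ∣ ≡ ∣ x m ℚ.- x n ∣
    flip m n = trans (cong ∣_∣ (sym (ℚₚ.neg-distrib-+ (x m) (ℚ.- x n)))) (ℚₚ.∣-p∣≡∣p∣ (x m ℚ.- x n))

  bounded : ∀ {x} → IsCauchy x →
            ∃ λ B → 0ℚ ℚ.< B × ∃ λ N → ∀ n → N ℕ.≤ n → ∣ x n ∣ ℚ.≤ B
  bounded {x} cx = 1ℚ ℚ.+ ∣ x N ∣ , 0<B , N , bound
    where
    N = proj₁ (cx 1ℚ (ℚₚ.positive⁻¹ 1ℚ))
    0<B : 0ℚ ℚ.< 1ℚ ℚ.+ ∣ x N ∣
    0<B = ℚₚ.+-mono-<-≤ (ℚₚ.positive⁻¹ 1ℚ) (ℚₚ.0≤∣p∣ (x N))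
    split : ∀ a b → a ≡ (a ℚ.- b) ℚ.+ b
    split = solve 2 (λ a b → a := (a :- b) :+ b) refl
      where open +-*-Solver
    bound : ∀ n → N ℕ.≤ n → ∣ x n ∣ ℚ.≤ 1ℚ ℚ.+ ∣ x N ∣
    bound n p = begin
      ∣ x n ∣                        ≡⟨ cong ∣_∣ (split (x n) (x N)) ⟩
      ∣ (x n ℚ.- x N) ℚ.+ x N ∣      ≤⟨ ℚₚ.∣p+q∣≤∣p∣+∣q∣ (x n ℚ.- x N) (x N) ⟩
      ∣ x n ℚ.- x N ∣ ℚ.+ ∣ x N ∣    ≤⟨ ℚₚ.+-monoˡ-≤ ∣ x N ∣ (ℚₚ.<⇒≤ (proj₂ (cx 1ℚ (ℚₚ.positive⁻¹ 1ℚ)) n N p ℕₚ.≤-refl)) ⟩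
      1ℚ ℚ.+ ∣ x N ∣ ∎
      where open ℚₚ.≤-Reasoning

  quotient : ∀ C → 0ℚ ℚ.< C → ∀ ε → 0ℚ ℚ.< ε → ∃ λ δ → 0ℚ ℚ.< δ × C ℚ.* δ ≡ ε
  quotient C 0<C ε 0<ε = 1/ C ℚ.* ε , ℚₚ.positive⁻¹ (1/ C ℚ.* ε) {{posδ}} , Cδ≡ε
    where
    instance
      posC : ℚ.Positive C
      posC = positive 0<C
      nzC : ℚ.NonZero C
      nzC = ℚₚ.pos⇒nonZero C
    posδ : ℚ.Positive (1/ C ℚ.* ε)
    posδ = ℚₚ.pos*pos⇒pos (1/ C) {{ℚₚ.1/pos⇒pos C}} ε {{positive 0<ε}}
    Cδ≡ε : C ℚ.* (1/ C ℚ.* ε) ≡ ε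
    Cδ≡ε = trans (sym (ℚₚ.*-assoc C (1/ C) ε))
          (trans (cong (ℚ._* ε) (ℚₚ.*-inverseʳ C)) (ℚₚ.*-identityˡ ε))

  ∣c*d∣<Cδ : ∀ {C δ} c d → 0ℚ ℚ.< C → ∣ c ∣ ℚ.≤ C → ∣ d ∣ ℚ.< δ → ∣ c ℚ.* d ∣ ℚ.< C ℚ.* δ
  ∣c*d∣<Cδ {C} {δ} c d 0<C c≤C d<δ = begin-strict
    ∣ c ℚ.* d ∣        ≡⟨ ℚₚ.∣p*q∣≡∣p∣*∣q∣ c d ⟩
    ∣ c ∣ ℚ.* ∣ d ∣    ≤⟨ ℚₚ.*-monoʳ-≤-nonNeg ∣ d ∣ {{nonNegative (ℚₚ.0≤∣p∣ d)}} c≤C ⟩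
    C ℚ.* ∣ d ∣        <⟨ ℚₚ.*-monoʳ-<-pos C {{positive 0<C}} d<δ ⟩
    C ℚ.* δ ∎
    where open ℚₚ.≤-Reasoning

  ab-cd : ∀ a b c d → (a ℚ.* b) ℚ.- (c ℚ.* d) ≡ a ℚ.* (b ℚ.- d) ℚ.+ d ℚ.* (a ℚ.- c)
  ab-cd = solve 4 (λ a b c d → (a :* b) :- (c :* d) := a :* (b :- d) :+ d :* (a :- c)) refl
    where open +-*-Solver

  ∣ab-cd∣<ε : ∀ {A B δ ε} a b c d → 0ℚ ℚ.< A → 0ℚ ℚ.< B → (A ℚ.+ B) ℚ.* δ ≡ ε →
              ∣ a ∣ ℚ.≤ A → ∣ d ∣ ℚ.≤ B → ∣ b ℚ.- d ∣ ℚ.< δ → ∣ a ℚ.- c ∣ ℚ.< δ →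
              ∣ (a ℚ.* b) ℚ.- (c ℚ.* d) ∣ ℚ.< ε
  ∣ab-cd∣<ε {A} {B} {δ} {ε} a b c d 0<A 0<B Cδ≡ε a≤A d≤B b-d<δ a-c<δ = begin-strict
    ∣ (a ℚ.* b) ℚ.- (c ℚ.* d) ∣                        ≡⟨ cong ∣_∣ (ab-cd a b c d) ⟩
    ∣ a ℚ.* (b ℚ.- d) ℚ.+ d ℚ.* (a ℚ.- c) ∣            ≤⟨ ℚₚ.∣p+q∣≤∣p∣+∣q∣ (a ℚ.* (b ℚ.- d)) (d ℚ.* (a ℚ.- c)) ⟩
    ∣ a ℚ.* (b ℚ.- d) ∣ ℚ.+ ∣ d ℚ.* (a ℚ.- c) ∣        <⟨ ℚₚ.+-mono-< (∣c*d∣<Cδ a (b ℚ.- d) 0<A a≤A b-d<δ)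
                                                                      (∣c*d∣<Cδ d (a ℚ.- c) 0<B d≤B a-c<δ) ⟩
    A ℚ.* δ ℚ.+ B ℚ.* δ                                ≡⟨ ℚₚ.*-distribʳ-+ δ A B ⟨
    (A ℚ.+ B) ℚ.* δ                                    ≡⟨ Cδ≡ε ⟩
    ε ∎
    where open ℚₚ.≤-Reasoning

  *-cauchy : ∀ {x y} → IsCauchy x → IsCauchy y → IsCauchy (λ n → x n ℚ.* y n)
  *-cauchy {x} {y} cx cy ε 0<ε =
    let A , 0<A , K , x≤A = bounded cx
        B , 0<B , L , y≤B = bounded cy
        δ , 0<δ , Cδ≡ε    = quotient (A ℚ.+ B) (ℚₚ.+-mono-< 0<A 0<B) ε 0<ε
        M , xM            = cx δ 0<δ
        N , yN            = cy δ 0<δ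
    in (K ⊔ L) ⊔ (M ⊔ N) , λ m n p q →
      let p₁ = ℕₚ.m⊔n≤o⇒m≤o (K ⊔ L) (M ⊔ N) p
          p₂ = ℕₚ.m⊔n≤o⇒n≤o (K ⊔ L) (M ⊔ N) p
          q₁ = ℕₚ.m⊔n≤o⇒m≤o (K ⊔ L) (M ⊔ N) q
          q₂ = ℕₚ.m⊔n≤o⇒n≤o (K ⊔ L) (M ⊔ N) q
      in ∣ab-cd∣<ε (x m) (y m) (x n) (y n) 0<A 0<B Cδ≡ε
           (x≤A m (ℕₚ.m⊔n≤o⇒m≤o K L p₁)) (y≤B n (ℕₚ.m⊔n≤o⇒n≤o K L q₁))
           (yN m n (ℕₚ.m⊔n≤o⇒n≤o M N p₂) (ℕₚ.m⊔n≤o⇒n≤o M N q₂))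
           (xM m n (ℕₚ.m⊔n≤o⇒m≤o M N p₂) (ℕₚ.m⊔n≤o⇒m≤o M N q₂))

infixl 6 _+ᵣ_ _-ᵣ_
infixl 7 _*ᵣ_
infix  8 -ᵣ_

fromℚ : ℚ → ℝ
fromℚ q = mkℝ (λ _ → q) (const-cauchy q)

0ᵣ 1ᵣ : ℝ
0ᵣ = fromℚ 0ℚ
1ᵣ = fromℚ 1ℚ

-ᵣ_ : ℝ → ℝ
-ᵣ x = mkℝ (λ n → ℚ.- seq x n) (neg-cauchy {seq x} (cauchy x))

_+ᵣ_ _-ᵣ_ _*ᵣ_ : ℝ → ℝ → ℝ
x +ᵣ y = mkℝ (λ n → seq x n ℚ.+ seq y n) (+-cauchy {seq x} {seq y} (cauchy x) (cauchy y))
x -ᵣ y = x +ᵣ (-ᵣ y)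
x *ᵣ y = mkℝ (λ n → seq x n ℚ.* seq y n) (*-cauchy {seq x} {seq y} (cauchy x) (cauchy y))

record ℂ : Set where
  constructor _+i_
  field
    re im : ℝ
open ℂ public

infix  4 _≈_
infixl 6 _+_
infixl 7 _*_

_≈_ : ℂ → ℂ → Set
z ≈ w = re z ≈ᵣ re w × im z ≈ᵣ im w

fromℝ : ℝ → ℂ
fromℝ x = x +i 0ᵣ

0ᶜ 1ᶜ : ℂ
0ᶜ = fromℝ 0ᵣ
1ᶜ = fromℝ 1ᵣ

_+_ _*_ : ℂ → ℂ → ℂ
z + w = (re z +ᵣ re w) +i (im z +ᵣ im w)
z * w = (re z *ᵣ re w -ᵣ im z *ᵣ im w) +i (re z *ᵣ im w +ᵣ im z *ᵣ re w)

_/!_ : ℂ → ℕ → ℂ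
z /! n = z * fromℝ (fromℚ ((+ 1 / (n !)) {{n ℕₚ.!≢0}}))

IsReal IsPurelyImaginary : ℂ → Set
IsReal z            = im z ≈ᵣ 0ᵣ
IsPurelyImaginary z = re z ≈ᵣ 0ᵣ

-- Coefficient list, constant term first.
Polynomial : Set
Polynomial = List ℂ

eval : Polynomial → ℂ → ℂ
eval []      s = 0ᶜ
eval (a ∷ p) s = a + s * eval p s

-- Formal power series in z: f n is the coefficient of zⁿ.
PowerSeries : Set
PowerSeries = ℕ → ℂ

infix 4 _≋_

_≋_ : PowerSeries → PowerSeries → Set
f ≋ g = ∀ n → f n ≈ g n

-- ∑≤ n a = a 0 + … + a n
∑≤ : ℕ → (ℕ → ℂ) → ℂ
∑≤ zero    a = a 0
∑≤ (suc n) a = ∑≤ n a + a (suc n)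

oneₛ : PowerSeries
oneₛ zero    = 1ᶜ
oneₛ (suc _) = 0ᶜ

_*ₛ_ : PowerSeries → PowerSeries → PowerSeries
(f *ₛ g) n = ∑≤ n λ i → f i * g (n ∸ i)

_^ₛ_ : PowerSeries → ℕ → PowerSeries
f ^ₛ zero  = oneₛ
f ^ₛ suc k = f *ₛ (f ^ₛ k)

-- e^f = ∑ₖ fᵏ / k! for a series f without constant term: then zᵏ divides fᵏ,
-- so only the terms with k ≤ n contribute to the coefficient of zⁿ.
expₛ : PowerSeries → PowerSeries
expₛ f n = ∑≤ n λ k → (f ^ₛ k) n /! k

-- c z s + α z² + β z⁴ as a power series in z
exponent : (α β c : ℝ) (s : ℂ) → PowerSeries
exponent α β c s 1 = fromℝ c * s
exponent α β c s 2 = fromℝ α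
exponent α β c s 4 = fromℝ β
exponent α β c s _ = 0ᶜ

GeneratedBy : (α β c : ℝ) → (ℕ → Polynomial) → Set
GeneratedBy α β c P = ∀ s → (λ m → eval (P m) s /! m) ≋ expₛ (exponent α β c s)

{-# OPTIONS --safe #-}

-- Put x = c s and w = x². The coefficients of exp(x z + α z² + β z⁴) arise from the Hermite polynomials
-- exp(d D²) xᵐ by the linear functional Ψ with Ψ(dᵏ) = k! [tᵏ] exp(α t + β t²). Up to a factor x, the Hermite
-- polynomial is the diagonal of a polynomial in n = ⌊m/2⌋ variables d₁, …, dₙ that has degree at most one in each:
-- a continuant in which dᵢ multiplies the (2i-1)st and the 2i-th coefficient of the recurrence. Its continued
-- fraction shows that it does not vanish when w is not real and all dᵢ lie in the closed half plane (with ∞)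
-- bounded by ℝ on the side of w. Now dₙ is eliminated: Ψ(A + dₙ B) = Ψ(A + α B + 2β Σᵢ ∂ᵢB), and for β < 0 the
-- right-hand argument, a polynomial in d₁, …, dₙ₋₁, again has no zeros there, because A/B and B/∂ᵢB lie in the
-- open half plane. After n eliminations a nonzero constant is left, so Pₘ(s) ≠ 0 whenever w is not real.
module Submission where

open import Algebra.Bundles using (CommutativeSemiring)
open import Algebra.Structures.Biased using (isCommutativeMonoidˡ; isCommutativeSemiringˡ)
open import Axiom.ExcludedMiddle using (ExcludedMiddle)
open import Data.Empty using (⊥-elim)
open import Data.Integer as ℤ using (+_)
import Data.Integer.Properties as ℤₚ
open import Data.Nat as ℕ using (ℕ; zero; suc; z≤n; s≤s; _⊔_; _!)
import Data.Nat.Properties as ℕₚ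
open import Data.Product using (∃; _×_; _,_; proj₁; proj₂)
open import Data.Rational as ℚ using (ℚ; 0ℚ; 1ℚ; ½; ∣_∣; _/_; 1/_; toℚᵘ; positive; nonNegative)
import Data.Rational.Properties as ℚₚ
open import Data.Rational.Solver using (module +-*-Solver)
open import Data.Rational.Unnormalised as ℚᵘ using (mkℚᵘ; *≡*)
import Data.Rational.Unnormalised.Properties as ℚᵘₚ
open import Data.Sum using (_⊎_; inj₁; inj₂)
open import Data.Vec using (Vec; []; _∷_)
open import Data.Vec.Relation.Unary.All using (All; []; _∷_)
open import Level using (0ℓ)
open import Relation.Binary.PropositionalEquality as ≡ using (_≡_)
open import Relation.Binary.Structures using (IsEquivalence)
open import Relation.Nullary using (¬_; Dec; yes; no)

-- Splitting d into several variables costs nothing, because Ψ treats them all alike and sees only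
-- the diagonal; in return they can be removed one at a time. How the variables are shared matters.
-- By Euler's rule a continuant never multiplies two adjacent coefficients, so a shared variable
-- still has degree at most one. With a separate variable for each coefficient, nonvanishing fails
-- already at m = 4: (w + 2d₁)(w + 6d₃) + 4d₂w has zeros with w = i, large real d₁, d₃ > 0 and Im d₂
-- > 0. Half planes are expressed by the sign of Im w · Im(X Z̄), which avoids division, admits ∞
-- and treats both signs of Im w alike. The sign of β enters through the antisymmetry of Im(X Z̄):
-- if B/∂ᵢB lies on the side of w, then ∂ᵢB/B lies on the other side, and the factor 2β brings it
-- back.

double : ℕ → ℕ
double zero    = 0
double (suc k) = suc (suc (double k))

halve : ∀ m → ∃ λ k → m ≡ double k ⊎ m ≡ suc (double k)
halve zero = 0 , inj₁ ≡.refl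
halve (suc m) with halve m
... | k , inj₁ eq = k , inj₂ (≡.cong suc eq)
... | k , inj₂ eq = suc k , inj₁ (≡.cong suc eq)

-- Polynomials of degree at most one in each variable

module MultiAffinePolynomials (C : CommutativeSemiring 0ℓ 0ℓ) where
  open CommutativeSemiring C
  open import Algebra.Solver.Ring.NaturalCoefficients.Default C
  open import Relation.Binary.Reasoning.Setoid setoid

  ν : ℕ → Carrier
  ν zero    = 0#
  ν (suc n) = 1# + ν n

  infixr 5 _+X·_
  infixl 6 _⊕_
  infixl 7 _⊙_

  data MultiAffine : ℕ → Set where
    const : Carrier → MultiAffine 0
    _+X·_ : ∀ {n} → MultiAffine n → MultiAffine n → MultiAffine (suc n)

  _⊕_ : ∀ {n} → MultiAffine n → MultiAffine n → MultiAffine n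
  const a   ⊕ const b   = const (a + b)
  (A +X· B) ⊕ (F +X· G) = (A ⊕ F) +X· (B ⊕ G)

  _⊙_ : ∀ {n} → Carrier → MultiAffine n → MultiAffine n
  t ⊙ const a   = const (t * a)
  t ⊙ (A +X· B) = (t ⊙ A) +X· (t ⊙ B)

  -- The sum of all first-order partial derivatives.
  ∂ : ∀ {n} → MultiAffine n → MultiAffine n
  ∂ (const a)  = const 0#
  ∂ (A +X· B) = (∂ A ⊕ B) +X· ∂ B

  Points : ℕ → Set
  Points = Vec (Carrier × Carrier)

  -- Evaluation at points (a : b) of the projective line, homogenised in each variable.
  ev : ∀ {n} → MultiAffine n → Points n → Carrier
  ev (const a)  []             = a
  ev (A +X· B) ((a , b) ∷ ps) = b * ev A ps + a * ev B ps

  ev-⊕ : ∀ {n} (f g : MultiAffine n) ps → ev (f ⊕ g) ps ≈ ev f ps + ev g ps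
  ev-⊕ (const a) (const b) [] = refl
  ev-⊕ (A +X· B) (F +X· G) ((a , b) ∷ ps) = begin
    b * ev (A ⊕ F) ps + a * ev (B ⊕ G) ps
      ≈⟨ +-cong (*-congˡ (ev-⊕ A F ps)) (*-congˡ (ev-⊕ B G ps)) ⟩
    b * (ev A ps + ev F ps) + a * (ev B ps + ev G ps)
      ≈⟨ solve 6 (λ a b A B F G → b :* (A :+ F) :+ a :* (B :+ G) := (b :* A :+ a :* B) :+ (b :* F :+ a :* G))
           refl a b (ev A ps) (ev B ps) (ev F ps) (ev G ps) ⟩
    (b * ev A ps + a * ev B ps) + (b * ev F ps + a * ev G ps) ∎

  ev-⊙ : ∀ {n} t (f : MultiAffine n) ps → ev (t ⊙ f) ps ≈ t * ev f ps
  ev-⊙ t (const a) [] = refl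
  ev-⊙ t (A +X· B) ((a , b) ∷ ps) = begin
    b * ev (t ⊙ A) ps + a * ev (t ⊙ B) ps
      ≈⟨ +-cong (*-congˡ (ev-⊙ t A ps)) (*-congˡ (ev-⊙ t B ps)) ⟩
    b * (t * ev A ps) + a * (t * ev B ps)
      ≈⟨ solve 5 (λ a b t A B → b :* (t :* A) :+ a :* (t :* B) := t :* (b :* A :+ a :* B))
           refl a b t (ev A ps) (ev B ps) ⟩
    t * (b * ev A ps + a * ev B ps) ∎

  ev-∂-⊕ : ∀ {n} (f g : MultiAffine n) ps → ev (∂ (f ⊕ g)) ps ≈ ev (∂ f) ps + ev (∂ g) ps
  ev-∂-⊕ (const a) (const b) [] = sym (+-identityʳ 0#)
  ev-∂-⊕ (A +X· B) (F +X· G) ((a , b) ∷ ps) = begin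
    b * ev (∂ (A ⊕ F) ⊕ (B ⊕ G)) ps + a * ev (∂ (B ⊕ G)) ps
      ≈⟨ +-cong (*-congˡ (trans (ev-⊕ (∂ (A ⊕ F)) (B ⊕ G) ps) (+-cong (ev-∂-⊕ A F ps) (ev-⊕ B G ps))))
                (*-congˡ (ev-∂-⊕ B G ps)) ⟩
    b * ((ev (∂ A) ps + ev (∂ F) ps) + (ev B ps + ev G ps)) + a * (ev (∂ B) ps + ev (∂ G) ps)
      ≈⟨ solve 8 (λ a b A B F G B' G' → b :* ((A :+ F) :+ (B' :+ G')) :+ a :* (B :+ G)
                     := (b :* (A :+ B') :+ a :* B) :+ (b :* (F :+ G') :+ a :* G))
           refl a b (ev (∂ A) ps) (ev (∂ B) ps) (ev (∂ F) ps) (ev (∂ G) ps) (ev B ps) (ev G ps) ⟩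
    (b * (ev (∂ A) ps + ev B ps) + a * ev (∂ B) ps) + (b * (ev (∂ F) ps + ev G ps) + a * ev (∂ G) ps)
      ≈⟨ +-cong (+-congʳ (*-congˡ (ev-⊕ (∂ A) B ps))) (+-congʳ (*-congˡ (ev-⊕ (∂ F) G ps))) ⟨
    (b * ev (∂ A ⊕ B) ps + a * ev (∂ B) ps) + (b * ev (∂ F ⊕ G) ps + a * ev (∂ G) ps) ∎

  ev-∂-⊙ : ∀ {n} t (f : MultiAffine n) ps → ev (∂ (t ⊙ f)) ps ≈ t * ev (∂ f) ps
  ev-∂-⊙ t (const a) [] = sym (zeroʳ t)
  ev-∂-⊙ t (A +X· B) ((a , b) ∷ ps) = begin
    b * ev (∂ (t ⊙ A) ⊕ t ⊙ B) ps + a * ev (∂ (t ⊙ B)) ps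
      ≈⟨ +-cong (*-congˡ (trans (ev-⊕ (∂ (t ⊙ A)) (t ⊙ B) ps) (+-cong (ev-∂-⊙ t A ps) (ev-⊙ t B ps))))
                (*-congˡ (ev-∂-⊙ t B ps)) ⟩
    b * (t * ev (∂ A) ps + t * ev B ps) + a * (t * ev (∂ B) ps)
      ≈⟨ solve 6 (λ a b t A B B' → b :* (t :* A :+ t :* B') :+ a :* (t :* B) := t :* (b :* (A :+ B') :+ a :* B))
           refl a b t (ev (∂ A) ps) (ev (∂ B) ps) (ev B ps) ⟩
    t * (b * (ev (∂ A) ps + ev B ps) + a * ev (∂ B) ps)
      ≈⟨ *-congˡ (+-congʳ (*-congˡ (ev-⊕ (∂ A) B ps))) ⟨
    t * (b * ev (∂ A ⊕ B) ps + a * ev (∂ B) ps) ∎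

  restrict : ∀ {n} → Carrier × Carrier → MultiAffine (suc n) → MultiAffine n
  restrict (a , b) (A +X· B) = b ⊙ A ⊕ a ⊙ B

  ev-restrict : ∀ {n} p (f : MultiAffine (suc n)) ps → ev (restrict p f) ps ≈ ev f (p ∷ ps)
  ev-restrict (a , b) (A +X· B) ps = trans (ev-⊕ (b ⊙ A) (a ⊙ B) ps) (+-cong (ev-⊙ b A ps) (ev-⊙ a B ps))

  -- The derivative by the first variable is `B`, of degree zero in that variable; homogenising it
  -- to degree one multiplies it by b.
  ev-∂-restrict : ∀ {n} a b (A B : MultiAffine n) ps →
    ev (∂ (A +X· B)) ((a , b) ∷ ps) ≈ ev (∂ (restrict (a , b) (A +X· B))) ps + b * ev B ps
  ev-∂-restrict a b A B ps = begin
    b * ev (∂ A ⊕ B) ps + a * ev (∂ B) ps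
      ≈⟨ +-congʳ (*-congˡ (ev-⊕ (∂ A) B ps)) ⟩
    b * (ev (∂ A) ps + ev B ps) + a * ev (∂ B) ps
      ≈⟨ solve 5 (λ a b A B B' → b :* (A :+ B') :+ a :* B := (b :* A :+ a :* B) :+ b :* B')
           refl a b (ev (∂ A) ps) (ev (∂ B) ps) (ev B ps) ⟩
    (b * ev (∂ A) ps + a * ev (∂ B) ps) + b * ev B ps
      ≈⟨ +-congʳ (trans (ev-∂-⊕ (b ⊙ A) (a ⊙ B) ps) (+-cong (ev-∂-⊙ b A ps) (ev-∂-⊙ a B ps))) ⟨
    ev (∂ (b ⊙ A ⊕ a ⊙ B)) ps + b * ev B ps ∎

  -- The functional Ψ and the elimination of one variable

  module Moments (α γ : Carrier) where

    -- With γ = 2β, moment f j is Ψ(∂ʲ f), and raise encodes Ψ(∂ʲ(X f)) = j Ψ(∂ʲ⁻¹ f) + α Ψ(∂ʲ f) + γ Ψ(∂ʲ⁺¹ f).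
    raise : (ℕ → Carrier) → ℕ → Carrier
    raise g zero    = α * g 0 + γ * g 1
    raise g (suc j) = ν (suc j) * g j + (α * g (suc j) + γ * g (suc (suc j)))

    raise-cong : ∀ {g h} → (∀ j → g j ≈ h j) → ∀ j → raise g j ≈ raise h j
    raise-cong e zero    = +-cong (*-congˡ (e 0)) (*-congˡ (e 1))
    raise-cong e (suc j) = +-cong (*-congˡ (e j)) (+-cong (*-congˡ (e (suc j))) (*-congˡ (e (suc (suc j)))))

    raise-+ : ∀ g h j → raise (λ i → g i + h i) j ≈ raise g j + raise h j
    raise-+ g h zero = solve 6 (λ α γ a b c d → α :* (a :+ b) :+ γ :* (c :+ d) := (α :* a :+ γ :* c) :+ (α :* b :+ γ :* d))
      refl α γ (g 0) (h 0) (g 1) (h 1)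
    raise-+ g h (suc j) = solve 9 (λ α γ n a b c d e f →
        n :* (e :+ f) :+ (α :* (a :+ b) :+ γ :* (c :+ d)) := (n :* e :+ (α :* a :+ γ :* c)) :+ (n :* f :+ (α :* b :+ γ :* d)))
      refl α γ (ν (suc j)) (g (suc j)) (h (suc j)) (g (suc (suc j))) (h (suc (suc j))) (g j) (h j)

    raise-* : ∀ t g j → raise (λ i → t * g i) j ≈ t * raise g j
    raise-* t g zero = solve 5 (λ α γ t a c → α :* (t :* a) :+ γ :* (t :* c) := t :* (α :* a :+ γ :* c))
      refl α γ t (g 0) (g 1)
    raise-* t g (suc j) = solve 7 (λ α γ t n a c e →
        n :* (t :* e) :+ (α :* (t :* a) :+ γ :* (t :* c)) := t :* (n :* e :+ (α :* a :+ γ :* c)))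
      refl α γ t (ν (suc j)) (g (suc j)) (g (suc (suc j))) (g j)

    moment : ∀ {n} → MultiAffine n → ℕ → Carrier
    moment (const a) zero    = a
    moment (const a) (suc j) = 0#
    moment (A +X· B) j       = moment A j + raise (moment B) j

    moment-⊕ : ∀ {n} (f g : MultiAffine n) j → moment (f ⊕ g) j ≈ moment f j + moment g j
    moment-⊕ (const a) (const b) zero    = refl
    moment-⊕ (const a) (const b) (suc j) = sym (+-identityʳ 0#)
    moment-⊕ (A +X· B) (F +X· G) j = begin
      moment (A ⊕ F) j + raise (moment (B ⊕ G)) j
        ≈⟨ +-cong (moment-⊕ A F j) (trans (raise-cong (moment-⊕ B G) j) (raise-+ (moment B) (moment G) j)) ⟩
      (moment A j + moment F j) + (raise (moment B) j + raise (moment G) j)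
        ≈⟨ solve 4 (λ a b c d → (a :+ b) :+ (c :+ d) := (a :+ c) :+ (b :+ d)) refl
             (moment A j) (moment F j) (raise (moment B) j) (raise (moment G) j) ⟩
      (moment A j + raise (moment B) j) + (moment F j + raise (moment G) j) ∎

    moment-⊙ : ∀ {n} t (f : MultiAffine n) j → moment (t ⊙ f) j ≈ t * moment f j
    moment-⊙ t (const a) zero    = refl
    moment-⊙ t (const a) (suc j) = sym (zeroʳ t)
    moment-⊙ t (A +X· B) j = begin
      moment (t ⊙ A) j + raise (moment (t ⊙ B)) j
        ≈⟨ +-cong (moment-⊙ t A j) (trans (raise-cong (moment-⊙ t B) j) (raise-* t (moment B) j)) ⟩
      t * moment A j + t * raise (moment B) j
        ≈⟨ distribˡ t (moment A j) (raise (moment B) j) ⟨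
      t * (moment A j + raise (moment B) j) ∎

    -- `raise` stands for multiplication by X and the shift of the index for ∂, so this is the
    -- commutation rule ∂X = 1 + X∂.
    raise-suc : ∀ g j → raise g (suc j) ≈ g j + raise (λ i → g (suc i)) j
    raise-suc g zero = solve 2 (λ a b → (con 1 :+ con 0) :* a :+ b := a :+ b) refl (g 0) (α * g 1 + γ * g 2)
    raise-suc g (suc j) = solve 3 (λ n a b → (con 1 :+ n) :* a :+ b := a :+ (n :* a :+ b)) refl
      (ν (suc j)) (g (suc j)) (α * g (suc (suc j)) + γ * g (suc (suc (suc j))))

    -- On the diagonal, the sum of the partial derivatives becomes the derivative by d, which the
    -- index j counts.
    moment-∂ : ∀ {n} (f : MultiAffine n) j → moment (∂ f) j ≈ moment f (suc j)
    moment-∂ (const a) zero    = refl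
    moment-∂ (const a) (suc j) = refl
    moment-∂ (A +X· B) j = begin
      moment (∂ A ⊕ B) j + raise (moment (∂ B)) j
        ≈⟨ +-cong (trans (moment-⊕ (∂ A) B j) (+-congʳ (moment-∂ A j))) (raise-cong (moment-∂ B) j) ⟩
      (moment A (suc j) + moment B j) + raise (λ i → moment B (suc i)) j
        ≈⟨ +-assoc (moment A (suc j)) (moment B j) (raise (λ i → moment B (suc i)) j) ⟩
      moment A (suc j) + (moment B j + raise (λ i → moment B (suc i)) j)
        ≈⟨ +-congˡ (raise-suc (moment B) j) ⟨
      moment A (suc j) + raise (moment B) (suc j) ∎

    eliminate : ∀ {n} → MultiAffine (suc n) → MultiAffine n
    eliminate (A +X· B) = A ⊕ (α ⊙ B ⊕ γ ⊙ ∂ B)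

    -- The series E = exp(α t + β t²) satisfies E' = (α + 2β t) E. Dually, Ψ(d f) = α Ψ(f) + 2β
    -- Ψ(∂f), which is `raise` at index 0.
    moment-eliminate : ∀ {n} (f : MultiAffine (suc n)) → moment (eliminate f) 0 ≈ moment f 0
    moment-eliminate (A +X· B) = trans (moment-⊕ A (α ⊙ B ⊕ γ ⊙ ∂ B) 0) (+-congˡ
      (trans (moment-⊕ (α ⊙ B) (γ ⊙ ∂ B) 0)
             (+-cong (moment-⊙ α B 0) (trans (moment-⊙ γ (∂ B) 0) (*-congˡ (moment-∂ B 0))))))

    -- The coefficient 2n in the recurrence hₙ₊₁ = x hₙ + 2n d hₙ₋₁ of the Hermite polynomials hₙ =
    -- exp(d D²) xⁿ.
    2ν : ℕ → Carrier
    2ν n = (1# + 1#) * ν n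

    module Continuants (w : Carrier) where

      -- The Jacobi continued fraction of the Hermite polynomials exp(d D²) xᵐ, with w = x² and with
      -- a separate copy of d for each pair of adjacent coefficients: the diagonals of even k and odd k are
      -- exp(d D²) x²ᵏ and x exp(d D²) x²ᵏ⁺¹.
      even odd : ∀ k → MultiAffine k
      even zero    = const 1#
      even (suc k) = odd k +X· 2ν (suc (double k)) ⊙ even k
      odd zero     = const w
      odd (suc k)  = w ⊙ odd k +X· ((w * 2ν (suc (double k))) ⊙ even k ⊕ 2ν (double (suc k)) ⊙ odd k)

    -- Here `e j m` is meant to be Ψ(∂ʲ hₘ) / m!. Since the hₘ have the exponential generating
    -- function exp(x z + d z²), ∂ multiplies it by z², and Ψ turns exp(d z²) into exp(α z² + β z⁴).
    -- So `e j m` is the coefficient of zᵐ in z²ʲ exp(x z + α z² + β z⁴), and `e-rec` is the Hermite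
    -- recurrence divided by a factorial.
    module _ (x : Carrier) (e : ℕ → ℕ → Carrier)
      (e-0-0 : e 0 0 ≈ 1#) (e-suc-0 : ∀ j → e (suc j) 0 ≈ 0#)
      (e-0-1 : e 0 1 ≈ x) (e-suc-1 : ∀ j → e (suc j) 1 ≈ 0#)
      (e-rec : ∀ j n → ν (suc (suc n)) * e j (suc (suc n)) ≈ x * e j (suc n) + (1# + 1#) * raise (λ i → e i n) j)
      where
      open Continuants (x * x)

      fac : ℕ → Carrier
      fac zero    = 1#
      fac (suc n) = ν (suc n) * fac n

      -- Of the coefficient 2(n+1), the factor n+1 turns n! into (n+1)!, and the factor 2 is the one
      -- in `e-rec`.
      raise-2ν : ∀ n j (f : ℕ → Carrier) t → (∀ i → f i ≈ t * (fac n * e i n)) →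
        2ν (suc n) * raise f j ≈ t * (fac (suc n) * ((1# + 1#) * raise (λ i → e i n) j))
      raise-2ν n j f t f≈ = begin
        2ν (suc n) * raise f j
          ≈⟨ *-congˡ (trans (raise-cong (λ i → trans (f≈ i) (sym (*-assoc t (fac n) (e i n)))) j)
                            (raise-* (t * fac n) (λ i → e i n) j)) ⟩
        2ν (suc n) * ((t * fac n) * raise (λ i → e i n) j)
          ≈⟨ solve 4 (λ t f v r → ((con 1 :+ con 1) :* v) :* ((t :* f) :* r) := t :* ((v :* f) :* ((con 1 :+ con 1) :* r)))
               refl t (fac n) (ν (suc n)) (raise (λ i → e i n) j) ⟩
        t * (fac (suc n) * ((1# + 1#) * raise (λ i → e i n) j)) ∎

      -- Mutual induction along the Hermite recurrence. The odd case carries the additional factor x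
      -- that makes `odd` a polynomial in w; the factor 1 gives the even case the shape required by
      -- `raise-2ν`.
      moment-even : ∀ k j → moment (even k) j ≈ 1# * (fac (double k) * e j (double k))
      moment-odd : ∀ k j → moment (odd k) j ≈ x * (fac (suc (double k)) * e j (suc (double k)))

      moment-even zero zero    = sym (trans (*-identityˡ _) (trans (*-identityˡ _) e-0-0))
      moment-even zero (suc j) = sym (trans (*-identityˡ _) (trans (*-identityˡ _) (e-suc-0 j)))
      moment-even (suc k) j = begin
        moment (odd k) j + raise (moment (p ⊙ even k)) j
          ≈⟨ +-cong (moment-odd k j) (trans (raise-cong (moment-⊙ p (even k)) j) (raise-* p (moment (even k)) j)) ⟩
        x * (fac (suc n) * e j (suc n)) + p * raise (moment (even k)) j
          ≈⟨ +-congˡ (raise-2ν n j (moment (even k)) 1# (moment-even k)) ⟩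
        x * (fac (suc n) * e j (suc n)) + 1# * (fac (suc n) * ((1# + 1#) * raise (λ i → e i n) j))
          ≈⟨ solve 4 (λ x f e r → x :* (f :* e) :+ con 1 :* (f :* r) := f :* (x :* e :+ r)) refl
               x (fac (suc n)) (e j (suc n)) ((1# + 1#) * raise (λ i → e i n) j) ⟩
        fac (suc n) * (x * e j (suc n) + (1# + 1#) * raise (λ i → e i n) j)
          ≈⟨ *-congˡ (e-rec j n) ⟨
        fac (suc n) * (ν (suc (suc n)) * e j (suc (suc n)))
          ≈⟨ solve 3 (λ f v e → f :* (v :* e) := con 1 :* ((v :* f) :* e)) refl
               (fac (suc n)) (ν (suc (suc n))) (e j (suc (suc n))) ⟩
        1# * (fac (suc (suc n)) * e j (suc (suc n))) ∎
        where
        n = double k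
        p = 2ν (suc n)

      moment-odd zero zero = begin
        x * x                              ≈⟨ solve 1 (λ x → x :* x := x :* ((con 1 :+ con 0) :* con 1 :* x)) refl x ⟩
        x * ((1# + 0#) * 1# * x)           ≈⟨ *-congˡ (*-congˡ e-0-1) ⟨
        x * ((1# + 0#) * 1# * e 0 1) ∎
      moment-odd zero (suc j) = sym (trans (*-congˡ (trans (*-congˡ (e-suc-1 j)) (zeroʳ _))) (zeroʳ x))
      moment-odd (suc k) j = begin
        moment (w ⊙ odd k) j + raise (moment ((w * p) ⊙ even k ⊕ q ⊙ odd k)) j
          ≈⟨ +-cong (moment-⊙ w (odd k) j) (trans (raise-cong split j) (trans (raise-+ (λ i → (w * p) * moment (even k) i) (λ i → q * moment (odd k) i) j)
               (+-cong (raise-* (w * p) (moment (even k)) j) (raise-* q (moment (odd k)) j)))) ⟩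
        w * moment (odd k) j + ((w * p) * raise (moment (even k)) j + q * raise (moment (odd k)) j)
          ≈⟨ solve 5 (λ w o p a b → w :* o :+ ((w :* p) :* a :+ b) := w :* (o :+ p :* a) :+ b) refl
               w (moment (odd k) j) p (raise (moment (even k)) j) (q * raise (moment (odd k)) j) ⟩
        -- The bracket is the moment of `even (suc k)`: the even recurrence is hidden inside the odd
        -- one.
        w * (moment (odd k) j + p * raise (moment (even k)) j) + q * raise (moment (odd k)) j
          ≈⟨ +-cong (*-congˡ (+-congˡ (trans (raise-cong (moment-⊙ p (even k)) j) (raise-* p (moment (even k)) j))))
                    (sym (raise-2ν (suc n) j (moment (odd k)) x (moment-odd k))) ⟨
        w * moment (even (suc k)) j + x * (fac (suc (suc n)) * ((1# + 1#) * raise (λ i → e i (suc n)) j))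
          ≈⟨ +-congʳ (*-congˡ (moment-even (suc k) j)) ⟩
        (x * x) * (1# * (fac (suc (suc n)) * e j (suc (suc n)))) + x * (fac (suc (suc n)) * ((1# + 1#) * raise (λ i → e i (suc n)) j))
          ≈⟨ solve 4 (λ x f e r → (x :* x) :* (con 1 :* (f :* e)) :+ x :* (f :* r) := x :* (f :* (x :* e :+ r))) refl
               x (fac (suc (suc n))) (e j (suc (suc n))) ((1# + 1#) * raise (λ i → e i (suc n)) j) ⟩
        x * (fac (suc (suc n)) * (x * e j (suc (suc n)) + (1# + 1#) * raise (λ i → e i (suc n)) j))
          ≈⟨ *-congˡ (*-congˡ (e-rec j (suc n))) ⟨
        x * (fac (suc (suc n)) * (ν (suc (suc (suc n))) * e j (suc (suc (suc n)))))
          ≈⟨ solve 4 (λ x f v e → x :* (f :* (v :* e)) := x :* ((v :* f) :* e)) refl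
               x (fac (suc (suc n))) (ν (suc (suc (suc n)))) (e j (suc (suc (suc n)))) ⟩
        x * (fac (suc (suc (suc n))) * e j (suc (suc (suc n)))) ∎
        where
        w = x * x
        n = double k
        p = 2ν (suc n)
        q = 2ν (suc (suc n))
        split : ∀ i → moment ((w * p) ⊙ even k ⊕ q ⊙ odd k) i ≈ (w * p) * moment (even k) i + q * moment (odd k) i
        split i = trans (moment-⊕ ((w * p) ⊙ even k) (q ⊙ odd k) i) (+-cong (moment-⊙ (w * p) (even k) i) (moment-⊙ q (odd k) i))

  -- X ▷ Z and X ▶ Z stand for Im w · Im(X Z̄) ≥ 0 and > 0: X/Z lies in the closed or open half plane of w.
  record StabilityForm (w α γ : Carrier) : Set₁ where
    infix 4 _▷_ _▶_
    field
      _▷_ _▶_ : Carrier → Carrier → Set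
      ▷-resp  : ∀ {X X' Z Z'} → X ≈ X' → Z ≈ Z' → X ▷ Z → X' ▷ Z'
      ▶-respˡ : ∀ {X X' Z} → X ≈ X' → X ▶ Z → X' ▶ Z
      0▷      : ∀ Z → 0# ▷ Z
      ▷0      : ∀ X → X ▷ 0#
      ▷-+ˡ    : ∀ {X Y Z} → X ▷ Z → Y ▷ Z → X + Y ▷ Z
      ▷-+ʳ    : ∀ {X Y Z} → X ▷ Y → X ▷ Z → X ▷ Y + Z
      ▷-scale : ∀ t {X Z} → X ▷ Z → t * X ▷ t * Z
      ▶⇒▷     : ∀ {X Z} → X ▶ Z → X ▷ Z
      ▶-+▷    : ∀ {X Y Z} → X ▶ Z → Y ▷ Z → X + Y ▶ Z
      ▶⇒≉0    : ∀ {X Z} → X ▶ Z → ¬ X ≈ 0#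
      w▶      : ∀ {Z} → ¬ Z ≈ 0# → w * Z ▶ Z
      α▷      : ∀ Z → α * Z ▷ Z
      γ▷      : ∀ {Y Z} → Z ▷ Y → γ * Y ▷ Z
      ▶-or-zero : ∀ A B → A ▶ B ⊎ ∃ λ A' → A' ▷ B × B * A + A' * B ≈ 0#
      domain  : ∀ {X Y} → ¬ X ≈ 0# → ¬ Y ≈ 0# → ¬ X * Y ≈ 0#
      ν≉0     : ∀ n → ¬ ν (suc n) ≈ 0#
      ≈0?     : ∀ X → Dec (X ≈ 0#)

  -- Nonvanishing on products of half planes

  module Stability {w α γ : Carrier} (S : StabilityForm w α γ) where
    open StabilityForm S
    open Moments α γ
    open Continuants w

    InHalfPlane : Carrier × Carrier → Set
    InHalfPlane (a , b) = (¬ a ≈ 0# ⊎ ¬ b ≈ 0#) × a ▷ b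

    Stable : ∀ {n} → MultiAffine n → Set
    Stable f = ∀ ps → All InHalfPlane ps → ¬ ev f ps ≈ 0#

    1≉0 : ¬ 1# ≈ 0#
    1≉0 1≈0 = ν≉0 0 (trans (+-identityʳ 1#) 1≈0)

    stable-restrict : ∀ {n p} (f : MultiAffine (suc n)) → InHalfPlane p → Stable f → Stable (restrict p f)
    stable-restrict {p = p} f hp st ps hps f≈0 = st (p ∷ ps) (hp ∷ hps) (trans (sym (ev-restrict p f ps)) f≈0)

    -- The point at infinity (1 : 0) extracts the coefficient of the first variable.
    stable-leading : ∀ {n} {A B : MultiAffine n} → Stable (A +X· B) → Stable B
    stable-leading {A = A} {B} st ps hps B≈0 = st ((1# , 0#) ∷ ps) ((inj₁ 1≉0 , ▷0 1#) ∷ hps)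
      (trans (solve 2 (λ A B → con 0 :* A :+ con 1 :* B := B) refl (ev A ps) (ev B ps)) B≈0)

    -- Otherwise -A/B would lie in the closed half plane and be a zero in the first variable.
    -- Without subtraction, A' stands for -A; B ≉ 0 makes (A' : B) a genuine point.
    stable⇒▶ : ∀ {n} {A B : MultiAffine n} → Stable (A +X· B) → ∀ ps → All InHalfPlane ps → ev A ps ▶ ev B ps
    stable⇒▶ {A = A} {B} st ps hps with ▶-or-zero (ev A ps) (ev B ps)
    ... | inj₁ A▶B = A▶B
    ... | inj₂ (A' , A'▷B , f≈0) =
      ⊥-elim (st ((A' , ev B ps) ∷ ps) ((inj₂ (stable-leading {A = A} st ps hps) , A'▷B) ∷ hps) f≈0)

    -- A Gauss-Lucas argument, one variable at a time. The first variable contributes bB to ∂f, and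
    -- both terms of f = bA + aB lie on the right side of it: bA because A ▶ B, and aB because a ▷
    -- b.
    stable⇒▷∂ : ∀ {n} (f : MultiAffine n) → Stable f → ∀ ps → All InHalfPlane ps → ev f ps ▷ ev (∂ f) ps
    stable⇒▷∂ (const a) st [] [] = ▷0 a
    stable⇒▷∂ (A +X· B) st ((a , b) ∷ ps) (hp@(_ , a▷b) ∷ hps) =
      ▷-resp refl (sym (ev-∂-restrict a b A B ps)) (▷-+ʳ
        (▷-resp (ev-restrict (a , b) f ps) refl (stable⇒▷∂ (restrict (a , b) f) (stable-restrict f hp st) ps hps))
        (▷-+ˡ (▷-scale b (▶⇒▷ (stable⇒▶ st ps hps)))
              (▷-resp (*-comm (ev B ps) a) (*-comm (ev B ps) b) (▷-scale (ev B ps) a▷b))))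
      where f = A +X· B

    -- All three terms lie in the half plane relative to B, and A does so strictly, hence so does
    -- their sum. For γ ∂B this uses that γ reverses B ▷ ∂B.
    stable-eliminate : ∀ {n} (f : MultiAffine (suc n)) → Stable f → Stable (eliminate f)
    stable-eliminate (A +X· B) st ps hps = ▶⇒≉0 (▶-respˡ (sym expand)
      (▶-+▷ (stable⇒▶ st ps hps) (▷-+ˡ (α▷ (ev B ps)) (γ▷ (stable⇒▷∂ B (stable-leading {A = A} st) ps hps)))))
      where
      expand : ev (eliminate (A +X· B)) ps ≈ ev A ps + (α * ev B ps + γ * ev (∂ B) ps)
      expand = trans (ev-⊕ A (α ⊙ B ⊕ γ ⊙ ∂ B) ps) (+-congˡ
        (trans (ev-⊕ (α ⊙ B) (γ ⊙ ∂ B) ps) (+-cong (ev-⊙ α B ps) (ev-⊙ γ (∂ B) ps))))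

    stable⇒moment≉0 : ∀ {n} (f : MultiAffine n) → Stable f → ¬ moment f 0 ≈ 0#
    stable⇒moment≉0 (const a)     st = st [] []
    stable⇒moment≉0 f@(_ +X· _) st m≈0 =
      stable⇒moment≉0 (eliminate f) (stable-eliminate f st) (trans (moment-eliminate f) m≈0)

    ν▷ : ∀ n {X Z} → X ▷ Z → ν n * X ▷ Z
    ν▷ zero    {X} {Z} X▷Z = ▷-resp (sym (zeroˡ X)) refl (0▷ Z)
    ν▷ (suc n) {X} {Z} X▷Z = ▷-resp (solve 2 (λ X n → X :+ n :* X := (con 1 :+ n) :* X) refl X (ν n)) refl
      (▷-+ˡ X▷Z (ν▷ n X▷Z))

    ▷ν : ∀ n {X Z} → X ▷ Z → X ▷ ν n * Z
    ▷ν zero    {X} {Z} X▷Z = ▷-resp refl (sym (zeroˡ Z)) (▷0 X)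
    ▷ν (suc n) {X} {Z} X▷Z = ▷-resp refl (solve 2 (λ Z n → Z :+ n :* Z := (con 1 :+ n) :* Z) refl Z (ν n))
      (▷-+ʳ X▷Z (▷ν n X▷Z))

    2ν▷ : ∀ n {X Z} → X ▷ Z → 2ν n * X ▷ Z
    2ν▷ n {X} X▷Z = ▷-resp (solve 2 (λ v X → v :* X :+ v :* X := ((con 1 :+ con 1) :* v) :* X) refl (ν n) X) refl
      (▷-+ˡ (ν▷ n X▷Z) (ν▷ n X▷Z))

    ▷2ν : ∀ n {X Z} → X ▷ Z → X ▷ 2ν n * Z
    ▷2ν n {X} {Z} X▷Z = ▷-resp refl (solve 2 (λ v X → v :* X :+ v :* X := ((con 1 :+ con 1) :* v) :* X) refl (ν n) Z)
      (▷-+ʳ (▷ν n X▷Z) (▷ν n X▷Z))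

    2ν≉0 : ∀ n → ¬ 2ν (suc n) ≈ 0#
    2ν≉0 n = domain (λ 2≈0 → ν≉0 1 (trans (+-congˡ (+-identityʳ 1#)) 2≈0)) (ν≉0 n)

    -- (Y , Z) is pushed through the continued fraction from the far end; X = Y + w Z keeps X/Z in the half plane.
    combination≉0 : ∀ k Y Z ps → All InHalfPlane ps → ¬ Y + w * Z ≈ 0# → Y + w * Z ▷ Z →
      ¬ Y * ev (even k) ps + Z * ev (odd k) ps ≈ 0#
    combination≉0 zero Y Z [] [] X≉0 X▷Z eq =
      X≉0 (trans (solve 3 (λ Y Z w → Y :+ w :* Z := Y :* con 1 :+ Z :* w) refl Y Z w) eq)
    combination≉0 (suc k) Y Z ((a , b) ∷ ps) ((ab≉0 , a▷b) ∷ hps) X≉0 X▷Z eq =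
      combination≉0 k Y' Z' ps hps X'≉0 X'▷Z' (trans (sym step) eq)
      where
      U = ev (even k) ps
      V = ev (odd k) ps
      p = 2ν (suc (double k))
      q = 2ν (double (suc k))
      X = Y + w * Z
      -- The coefficients of U and V after one level of the continued fraction is expanded; Y enters
      -- them only through X.
      Y' = p * (a * X)
      Z' = b * X + q * (a * Z)

      step : Y * ev (even (suc k)) ((a , b) ∷ ps) + Z * ev (odd (suc k)) ((a , b) ∷ ps) ≈ Y' * U + Z' * V
      step = begin
        Y * (b * V + a * ev (p ⊙ even k) ps) + Z * (b * ev (w ⊙ odd k) ps + a * ev ((w * p) ⊙ even k ⊕ q ⊙ odd k) ps)
          ≈⟨ +-cong (*-congˡ (+-congˡ (*-congˡ (ev-⊙ p (even k) ps))))
                    (*-congˡ (+-cong (*-congˡ (ev-⊙ w (odd k) ps))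
                      (*-congˡ (trans (ev-⊕ ((w * p) ⊙ even k) (q ⊙ odd k) ps)
                                      (+-cong (ev-⊙ (w * p) (even k) ps) (ev-⊙ q (odd k) ps)))))) ⟩
        Y * (b * V + a * (p * U)) + Z * (b * (w * V) + a * ((w * p) * U + q * V))
          ≈⟨ solve 9 (λ Y Z a b w p q U V →
                 Y :* (b :* V :+ a :* (p :* U)) :+ Z :* (b :* (w :* V) :+ a :* ((w :* p) :* U :+ q :* V))
                   := (p :* (a :* (Y :+ w :* Z))) :* U :+ (b :* (Y :+ w :* Z) :+ q :* (a :* Z)) :* V)
               refl Y Z a b w p q U V ⟩
        Y' * U + Z' * V ∎

      Y'▷Z' : Y' ▷ Z'
      -- The two summands of Z': aX ▷ bX comes from a ▷ b, and aX ▷ aZ from X ▷ Z.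
      Y'▷Z' = 2ν▷ (suc (double k)) (▷-+ʳ
        (▷-resp (*-comm X a) (*-comm X b) (▷-scale X a▷b))
        (▷2ν (double (suc k)) (▷-scale a X▷Z)))

      wZ'▷Z' : w * Z' ▷ Z'
      wZ'▷Z' with ≈0? Z'
      ... | yes Z'≈0 = ▷-resp refl (sym Z'≈0) (▷0 (w * Z'))
      ... | no Z'≉0 = ▶⇒▷ (w▶ Z'≉0)

      X'▷Z' : Y' + w * Z' ▷ Z'
      X'▷Z' = ▷-+ˡ Y'▷Z' wZ'▷Z'

      X'≉0 : ¬ Y' + w * Z' ≈ 0#
      -- If Z' ≈ 0 and a ≉ 0, then X' reduces to p a X ≉ 0. If a ≈ 0, then Z' reduces to bX with b ≉
      -- 0, so Z' cannot vanish.
      X'≉0 with ≈0? Z' | ≈0? a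
      ... | no Z'≉0 | _ = ▶⇒≉0 (▶-respˡ (+-comm (w * Z') Y') (▶-+▷ (w▶ Z'≉0) Y'▷Z'))
      ... | yes Z'≈0 | no a≉0 = λ eq → domain (2ν≉0 (double k)) (domain a≉0 X≉0)
        (trans (sym (trans (+-congˡ (trans (*-congˡ Z'≈0) (zeroʳ w))) (+-identityʳ Y'))) eq)
      ... | yes Z'≈0 | yes a≈0 = λ _ → domain (b≉0 ab≉0) X≉0
        (trans (sym (trans (+-congˡ (trans (*-congˡ (trans (*-congʳ a≈0) (zeroˡ Z))) (zeroʳ q))) (+-identityʳ (b * X)))) Z'≈0)
        where
        b≉0 : ¬ a ≈ 0# ⊎ ¬ b ≈ 0# → ¬ b ≈ 0#
        b≉0 (inj₁ a≉0) = ⊥-elim (a≉0 a≈0)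
        b≉0 (inj₂ b≉0) = b≉0

    stable-even : ∀ k → Stable (even k)
    stable-even k ps hps eq = combination≉0 k 1# 0# ps hps
      (λ h → 1≉0 (trans (sym X≈1) h)) (▷0 _)
      (trans (solve 2 (λ u v → con 1 :* u :+ con 0 :* v := u) refl (ev (even k) ps) (ev (odd k) ps)) eq)
      where
      X≈1 : 1# + w * 0# ≈ 1#
      X≈1 = trans (+-congˡ (zeroʳ w)) (+-identityʳ 1#)

    stable-odd : ∀ k → Stable (odd k)
    stable-odd k ps hps eq = combination≉0 k 0# 1# ps hps
      (λ h → ▶⇒≉0 (w▶ 1≉0) (trans (sym (+-identityˡ (w * 1#))) h))
      (▷-resp (sym (+-identityˡ (w * 1#))) refl (▶⇒▷ (w▶ 1≉0)))
      (trans (solve 2 (λ u v → con 0 :* u :+ con 1 :* v := v) refl (ev (even k) ps) (ev (odd k) ps)) eq)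

-- The power series exp(x z + α z² + β z⁴)

module ExponentialSeries (C : CommutativeSemiring 0ℓ 0ℓ) where
  open CommutativeSemiring C
  open import Algebra.Solver.Ring.NaturalCoefficients.Default C
  open import Relation.Binary.Reasoning.Setoid setoid
  open MultiAffinePolynomials C

  -- Multiplication of a power series by z.
  σ : (ℕ → Carrier) → ℕ → Carrier
  σ g zero    = 0#
  σ g (suc n) = g n

  agree-σ : ∀ {g h N} → (∀ n → n ℕ.≤ N → g n ≈ h n) → ∀ n → n ℕ.≤ N → σ g n ≈ σ h n
  agree-σ e zero    _   = refl
  agree-σ e (suc n) n<N = e n (ℕₚ.<⇒≤ n<N)

  σ-cong : ∀ {g h} → (∀ n → g n ≈ h n) → ∀ n → σ g n ≈ σ h n
  σ-cong e zero    = refl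
  σ-cong e (suc n) = e n

  σ-+ : ∀ g h n → σ (λ m → g m + h m) n ≈ σ g n + σ h n
  σ-+ g h zero    = sym (+-identityʳ 0#)
  σ-+ g h (suc n) = refl

  σ-* : ∀ t g n → σ (λ m → t * g m) n ≈ t * σ g n
  σ-* t g zero    = sym (zeroʳ t)
  σ-* t g (suc n) = refl

  -- The Euler operator z d/dz, a derivation that, unlike d/dz, leaves the index in place.
  θ : (ℕ → Carrier) → ℕ → Carrier
  θ g n = ν n * g n

  θ-σ : ∀ g n → θ (σ g) n ≈ σ (θ g) n + σ g n
  θ-σ g zero    = solve 0 (con 0 :* con 0 := con 0 :+ con 0) refl
  θ-σ g (suc n) = solve 2 (λ v g → (con 1 :+ v) :* g := v :* g :+ g) refl (ν n) (g n)

  θ-σ² : ∀ g n → θ (σ (σ g)) n ≈ σ (σ (θ g)) n + (1# + 1#) * σ (σ g) n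
  θ-σ² g n = begin
    θ (σ (σ g)) n
      ≈⟨ θ-σ (σ g) n ⟩
    σ (θ (σ g)) n + σ (σ g) n
      ≈⟨ +-congʳ (trans (σ-cong (θ-σ g) n) (σ-+ (σ (θ g)) (σ g) n)) ⟩
    (σ (σ (θ g)) n + σ (σ g) n) + σ (σ g) n
      ≈⟨ solve 2 (λ a b → (a :+ b) :+ b := a :+ (con 1 :+ con 1) :* b) refl (σ (σ (θ g)) n) (σ (σ g) n) ⟩
    σ (σ (θ g)) n + (1# + 1#) * σ (σ g) n ∎

  -- Multiplication by the power series u z + v z² + t z⁴.
  module Multiplication (u v t : Carrier) where

    mul : (ℕ → Carrier) → ℕ → Carrier
    mul g n = u * σ g n + (v * σ (σ g) n + t * σ (σ (σ (σ g))) n)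

    -- Needed because a partial sum of the exponential series is correct only up to a bounded index.
    agree-mul : ∀ {g h N} → (∀ n → n ℕ.≤ N → g n ≈ h n) → ∀ n → n ℕ.≤ N → mul g n ≈ mul h n
    agree-mul e n n≤N = +-cong (*-congˡ (e₁ n n≤N)) (+-cong (*-congˡ (e₂ n n≤N)) (*-congˡ (agree-σ (agree-σ e₂) n n≤N)))
      where
      e₁ = agree-σ e
      e₂ = agree-σ e₁

    mul-cong : ∀ {g h} → (∀ n → g n ≈ h n) → ∀ n → mul g n ≈ mul h n
    mul-cong e n = agree-mul {N = n} (λ m _ → e m) n ℕₚ.≤-refl

    mul-+ : ∀ g h n → mul (λ m → g m + h m) n ≈ mul g n + mul h n
    mul-+ g h n = begin
      mul (λ m → g m + h m) n
        ≈⟨ +-cong (*-congˡ (e₁ n)) (+-cong (*-congˡ (e₂ n)) (*-congˡ (e₄ n))) ⟩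
      u * (σ g n + σ h n) + (v * (σ (σ g) n + σ (σ h) n) + t * (σ (σ (σ (σ g))) n + σ (σ (σ (σ h))) n))
        ≈⟨ solve 9 (λ u v t a b c d e f → u :* (a :+ b) :+ (v :* (c :+ d) :+ t :* (e :+ f))
               := (u :* a :+ (v :* c :+ t :* e)) :+ (u :* b :+ (v :* d :+ t :* f))) refl
             u v t (σ g n) (σ h n) (σ (σ g) n) (σ (σ h) n) (σ (σ (σ (σ g))) n) (σ (σ (σ (σ h))) n) ⟩
      mul g n + mul h n ∎
      where
      e₁ = σ-+ g h
      e₂ : ∀ n → σ (σ (λ m → g m + h m)) n ≈ σ (σ g) n + σ (σ h) n
      e₂ n = trans (σ-cong e₁ n) (σ-+ (σ g) (σ h) n)
      e₃ : ∀ n → σ (σ (σ (λ m → g m + h m))) n ≈ σ (σ (σ g)) n + σ (σ (σ h)) n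
      e₃ n = trans (σ-cong e₂ n) (σ-+ (σ (σ g)) (σ (σ h)) n)
      e₄ : ∀ n → σ (σ (σ (σ (λ m → g m + h m)))) n ≈ σ (σ (σ (σ g))) n + σ (σ (σ (σ h))) n
      e₄ n = trans (σ-cong e₃ n) (σ-+ (σ (σ (σ g))) (σ (σ (σ h))) n)

    mul-* : ∀ s g n → mul (λ m → s * g m) n ≈ s * mul g n
    mul-* s g n = begin
      mul (λ m → s * g m) n
        ≈⟨ +-cong (*-congˡ (e₁ n)) (+-cong (*-congˡ (e₂ n)) (*-congˡ (e₄ n))) ⟩
      u * (s * σ g n) + (v * (s * σ (σ g) n) + t * (s * σ (σ (σ (σ g))) n))
        ≈⟨ solve 7 (λ u v t s a c e → u :* (s :* a) :+ (v :* (s :* c) :+ t :* (s :* e))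
               := s :* (u :* a :+ (v :* c :+ t :* e))) refl
             u v t s (σ g n) (σ (σ g) n) (σ (σ (σ (σ g))) n) ⟩
      s * mul g n ∎
      where
      e₁ = σ-* s g
      e₂ : ∀ n → σ (σ (λ m → s * g m)) n ≈ s * σ (σ g) n
      e₂ n = trans (σ-cong e₁ n) (σ-* s (σ g) n)
      e₃ : ∀ n → σ (σ (σ (λ m → s * g m))) n ≈ s * σ (σ (σ g)) n
      e₃ n = trans (σ-cong e₂ n) (σ-* s (σ (σ g)) n)
      e₄ : ∀ n → σ (σ (σ (σ (λ m → s * g m)))) n ≈ s * σ (σ (σ (σ g))) n
      e₄ n = trans (σ-cong e₃ n) (σ-* s (σ (σ (σ g))) n)

    σ-mul : ∀ g n → σ (mul g) n ≈ mul (σ g) n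
    σ-mul g zero    = solve 3 (λ u v t → con 0 := u :* con 0 :+ (v :* con 0 :+ t :* con 0)) refl u v t
    σ-mul g (suc n) = refl

    σ²-mul : ∀ g n → σ (σ (mul g)) n ≈ mul (σ (σ g)) n
    σ²-mul g n = trans (σ-cong (σ-mul g) n) (σ-mul (σ g) n)

    σ⁴-mul : ∀ g n → σ (σ (σ (σ (mul g)))) n ≈ mul (σ (σ (σ (σ g)))) n
    σ⁴-mul g n = trans (σ-cong (σ-cong (σ²-mul g)) n) (σ²-mul (σ (σ g)) n)

  sum : ℕ → (ℕ → Carrier) → Carrier
  sum zero    a = a 0
  sum (suc n) a = sum n a + a (suc n)

  convolution : ∀ {x α β} (f g : ℕ → Carrier) → f 0 ≈ 0# → f 1 ≈ x → f 2 ≈ α → f 3 ≈ 0# → f 4 ≈ β → (∀ i → f (5 ℕ.+ i) ≈ 0#) →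
    ∀ n → sum n (λ i → f i * g (n ℕ.∸ i)) ≈ Multiplication.mul x α β g n
  convolution {x} {α} {β} f g f₀ f₁ f₂ f₃ f₄ f₅ = go
    where
    truncate : ∀ (a : ℕ → Carrier) → (∀ i → a (5 ℕ.+ i) ≈ 0#) → ∀ k → sum (4 ℕ.+ k) a ≈ sum 4 a
    truncate a a≈0 zero    = refl
    truncate a a≈0 (suc k) = trans (+-cong (truncate a a≈0 k) (a≈0 k)) (+-identityʳ _)

    go : ∀ n → sum n (λ i → f i * g (n ℕ.∸ i)) ≈ Multiplication.mul x α β g n
    -- For n < 4 the convolution has fewer than five terms, and the zeros introduced by `σ` stand
    -- for the missing ones.
    go 0 = trans (*-congʳ f₀)
      (solve 4 (λ x α β a → con 0 :* a := x :* con 0 :+ (α :* con 0 :+ β :* con 0)) refl x α β (g 0))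
    go 1 = trans (+-cong (*-congʳ f₀) (*-congʳ f₁))
      (solve 5 (λ x α β a b → con 0 :* b :+ x :* a := x :* a :+ (α :* con 0 :+ β :* con 0)) refl x α β (g 0) (g 1))
    go 2 = trans (+-cong (+-cong (*-congʳ f₀) (*-congʳ f₁)) (*-congʳ f₂))
      (solve 6 (λ x α β a b c → con 0 :* c :+ x :* b :+ α :* a := x :* b :+ (α :* a :+ β :* con 0)) refl x α β (g 0) (g 1) (g 2))
    go 3 = trans (+-cong (+-cong (+-cong (*-congʳ f₀) (*-congʳ f₁)) (*-congʳ f₂)) (*-congʳ f₃))
      (solve 7 (λ x α β a b c d → con 0 :* d :+ x :* c :+ α :* b :+ con 0 :* a := x :* c :+ (α :* b :+ β :* con 0)) refl
        x α β (g 0) (g 1) (g 2) (g 3))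
    go n@(suc (suc (suc (suc k)))) = trans (truncate (λ i → f i * g (n ℕ.∸ i)) (λ i → trans (*-congʳ (f₅ i)) (zeroˡ _)) k)
      (trans (+-cong (+-cong (+-cong (+-cong (*-congʳ f₀) (*-congʳ f₁)) (*-congʳ f₂)) (*-congʳ f₃)) (*-congʳ f₄))
        (solve 8 (λ x α β a b c d e → con 0 :* e :+ x :* d :+ α :* c :+ con 0 :* b :+ β :* a := x :* d :+ (α :* c :+ β :* a)) refl
          x α β (g k) (g (1 ℕ.+ k)) (g (2 ℕ.+ k)) (g (3 ℕ.+ k)) (g (4 ℕ.+ k))))

  -- The coefficients of exp f for f = x z + α z² + β z⁴, where f̂ is multiplication by f and f̂' is multiplication by z f'.
  module Exponential (x α β : Carrier) where
    2# = 1# + 1#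
    open Multiplication x α β renaming (mul to f̂)
    -- 4β is written as 2(2β) because 2β is the parameter γ of `Moments`.
    module f' = Multiplication x (2# * α) (2# * (2# * β))
    open f' using () renaming (mul to f̂')

    -- The product rule θ(f g) = f θ(g) + z f' g.
    θ-f̂ : ∀ g n → θ (f̂ g) n ≈ f̂ (θ g) n + f̂' g n
    θ-f̂ g n = begin
      ν n * (x * g₁ + (α * g₂ + β * g₄))
        ≈⟨ solve 7 (λ v x α β a b c → v :* (x :* a :+ (α :* b :+ β :* c)) := x :* (v :* a) :+ (α :* (v :* b) :+ β :* (v :* c)))
             refl (ν n) x α β g₁ g₂ g₄ ⟩
      x * θ (σ g) n + (α * θ (σ (σ g)) n + β * θ (σ (σ (σ (σ g)))) n)
        ≈⟨ +-cong (*-congˡ (θ-σ g n)) (+-cong (*-congˡ (θ-σ² g n)) (*-congˡ θ-σ⁴)) ⟩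
      x * (h₁ + g₁) + (α * (h₂ + 2# * g₂) + β * ((h₄ + 2# * g₄) + 2# * g₄))
        ≈⟨ solve 9 (λ x α β a b c d e f →
               x :* (d :+ a) :+ (α :* (e :+ (con 1 :+ con 1) :* b) :+ β :* ((f :+ (con 1 :+ con 1) :* c) :+ (con 1 :+ con 1) :* c))
                 := (x :* d :+ (α :* e :+ β :* f))
                      :+ (x :* a :+ (((con 1 :+ con 1) :* α) :* b :+ ((con 1 :+ con 1) :* ((con 1 :+ con 1) :* β)) :* c)))
             refl x α β g₁ g₂ g₄ h₁ h₂ h₄ ⟩
      f̂ (θ g) n + f̂' g n ∎
      where
      g₁ = σ g n
      g₂ = σ (σ g) n
      g₄ = σ (σ (σ (σ g))) n
      h₁ = σ (θ g) n
      h₂ = σ (σ (θ g)) n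
      h₄ = σ (σ (σ (σ (θ g)))) n
      θ-σ⁴ : θ (σ (σ (σ (σ g)))) n ≈ (h₄ + 2# * g₄) + 2# * g₄
      θ-σ⁴ = trans (θ-σ² (σ (σ g)) n) (+-congʳ (begin
        σ (σ (θ (σ (σ g)))) n
          ≈⟨ σ-cong (σ-cong (θ-σ² g)) n ⟩
        σ (σ (λ m → σ (σ (θ g)) m + 2# * σ (σ g) m)) n
          ≈⟨ trans (σ-cong (σ-+ (σ (σ (θ g))) (λ m → 2# * σ (σ g) m)) n)
                   (σ-+ (σ (σ (σ (θ g)))) (σ (λ m → 2# * σ (σ g) m)) n) ⟩
        h₄ + σ (σ (λ m → 2# * σ (σ g) m)) n
          ≈⟨ +-congˡ (trans (σ-cong (σ-* 2# (σ (σ g))) n) (σ-* 2# (σ (σ (σ g))) n)) ⟩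
        h₄ + 2# * g₄ ∎))

    f̂-f̂' : ∀ g n → f̂ (f̂' g) n ≈ f̂' (f̂ g) n
    f̂-f̂' g n = begin
      f̂ (f̂' g) n
        ≈⟨ +-cong (*-congˡ (f'.σ-mul g n)) (+-cong (*-congˡ (f'.σ²-mul g n)) (*-congˡ (f'.σ⁴-mul g n))) ⟩
      x * f̂' (σ g) n + (α * f̂' (σ (σ g)) n + β * f̂' (σ (σ (σ (σ g)))) n)
        ≈⟨ solve 9 (λ x α β a b c d e f →
               let two = con 1 :+ con 1 ; α' = two :* α ; β' = two :* (two :* β) in
               x :* (x :* a :+ (α' :* b :+ β' :* d)) :+ (α :* (x :* b :+ (α' :* c :+ β' :* e)) :+ β :* (x :* d :+ (α' :* e :+ β' :* f)))
                 := x :* (x :* a :+ (α :* b :+ β :* d)) :+ (α' :* (x :* b :+ (α :* c :+ β :* e)) :+ β' :* (x :* d :+ (α :* e :+ β :* f))))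
             refl x α β (s 2) (s 3) (s 4) (s 5) (s 6) (s 8) ⟩
      x * f̂ (σ g) n + ((2# * α) * f̂ (σ (σ g)) n + (2# * (2# * β)) * f̂ (σ (σ (σ (σ g)))) n)
        ≈⟨ +-cong (*-congˡ (σ-mul g n)) (+-cong (*-congˡ (σ²-mul g n)) (*-congˡ (σ⁴-mul g n))) ⟨
      f̂' (f̂ g) n ∎
      where
      iter : ℕ → ℕ → Carrier
      iter zero    = g
      iter (suc i) = σ (iter i)
      s : ℕ → Carrier
      s i = iter i n

    module _ (power : ℕ → ℕ → Carrier) (inv : ℕ → Carrier)
      (power-0-0 : power 0 0 ≈ 1#) (power-0-suc : ∀ n → power 0 (suc n) ≈ 0#)
      (power-suc : ∀ k n → power (suc k) n ≈ f̂ (power k) n)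
      (inv-0 : inv 0 ≈ 1#) (inv-suc : ∀ k → ν (suc k) * inv (suc k) ≈ inv k)
      where

      θ-power-0 : ∀ n → θ (power 0) n ≈ 0#
      θ-power-0 zero    = zeroˡ (power 0 0)
      θ-power-0 (suc n) = trans (*-congˡ (power-0-suc n)) (zeroʳ (ν (suc n)))

      -- The power rule θ(fᵏ⁺¹) = (k+1) fᵏ z f'.
      θ-power-suc : ∀ k n → θ (power (suc k)) n ≈ ν (suc k) * f̂' (power k) n
      θ-power-suc k n = begin
        ν n * power (suc k) n               ≈⟨ *-congˡ (power-suc k n) ⟩
        θ (f̂ (power k)) n                   ≈⟨ θ-f̂ (power k) n ⟩
        f̂ (θ (power k)) n + f̂' (power k) n  ≈⟨ +-congʳ (lower k) ⟩
        ν k * f̂' (power k) n + f̂' (power k) n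
          ≈⟨ solve 2 (λ v a → v :* a :+ a := (con 1 :+ v) :* a) refl (ν k) (f̂' (power k) n) ⟩
        ν (suc k) * f̂' (power k) n ∎
        where
        -- The additional factor f avoids the exponent k - 1, so k = 0 fits the same formula.
        lower : ∀ k → f̂ (θ (power k)) n ≈ ν k * f̂' (power k) n
        lower zero = trans (mul-cong (λ m → trans (θ-power-0 m) (sym (zeroˡ 0#))) n)
                           (trans (mul-* 0# (λ _ → 0#) n) (trans (zeroˡ _) (sym (zeroˡ _))))
        lower (suc k) = begin
          f̂ (θ (power (suc k))) n                  ≈⟨ mul-cong (θ-power-suc k) n ⟩
          f̂ (λ m → ν (suc k) * f̂' (power k) m) n   ≈⟨ mul-* (ν (suc k)) (f̂' (power k)) n ⟩
          ν (suc k) * f̂ (f̂' (power k)) n           ≈⟨ *-congˡ (f̂-f̂' (power k) n) ⟩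
          ν (suc k) * f̂' (f̂ (power k)) n           ≈⟨ *-congˡ (f'.mul-cong (power-suc k) n) ⟨
          ν (suc k) * f̂' (power (suc k)) n ∎

      power-vanishes : ∀ k n → n ℕ.< k → power k n ≈ 0#
      power-vanishes (suc k) n (s≤s n≤k) = begin
        power (suc k) n
          ≈⟨ power-suc k n ⟩
        x * σ p n + (α * σ (σ p) n + β * σ (σ (σ (σ p))) n)
          ≈⟨ +-cong (*-congˡ (v₁ n n≤k)) (+-cong (*-congˡ (v₂ n n≤k)) (*-congˡ (vanish-σ (vanish-σ v₂) n n≤k))) ⟩
        x * 0# + (α * 0# + β * 0#)
          ≈⟨ solve 3 (λ u v t → u :* con 0 :+ (v :* con 0 :+ t :* con 0) := con 0) refl x α β ⟩
        0# ∎
        where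
        p = power k
        v₁ : ∀ n → n ℕ.≤ k → σ p n ≈ 0#
        v₁ zero    _   = refl
        v₁ (suc n) n<k = power-vanishes k n n<k
        vanish-σ : ∀ {g} → (∀ n → n ℕ.≤ k → g n ≈ 0#) → ∀ n → n ℕ.≤ k → σ g n ≈ 0#
        vanish-σ v zero    _   = refl
        vanish-σ v (suc n) n<k = v n (ℕₚ.<⇒≤ n<k)
        v₂ = vanish-σ v₁

      partialExp : ℕ → ℕ → Carrier
      partialExp zero    n = power 0 n * inv 0
      partialExp (suc K) n = partialExp K n + power (suc K) n * inv (suc K)

      exp : ℕ → Carrier
      exp n = partialExp n n

      partialExp≈exp : ∀ K n → n ℕ.≤ K → partialExp K n ≈ exp n
      partialExp≈exp K n n≤K = ≡.subst (λ L → partialExp L n ≈ exp n) (ℕₚ.m∸n+n≡m n≤K) (stable (K ℕ.∸ n))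
        where
        stable : ∀ d → partialExp (d ℕ.+ n) n ≈ exp n
        stable zero    = refl
        stable (suc d) = trans (+-cong (stable d)
          (trans (*-congʳ (power-vanishes (suc (d ℕ.+ n)) n (s≤s (ℕₚ.m≤n+m n d)))) (zeroˡ _))) (+-identityʳ _)

      -- Each term fᵏ⁺¹/(k+1)! is sent to z f' fᵏ/k!, so the sum loses one term.
      θ-partialExp : ∀ K n → θ (partialExp (suc K)) n ≈ f̂' (partialExp K) n
      θ-partialExp K n = begin
        ν n * (partialExp K n + power (suc K) n * inv (suc K))
          ≈⟨ solve 4 (λ v a b c → v :* (a :+ b :* c) := v :* a :+ c :* (v :* b)) refl
               (ν n) (partialExp K n) (power (suc K) n) (inv (suc K)) ⟩
        θ (partialExp K) n + inv (suc K) * θ (power (suc K)) n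
          ≈⟨ +-congˡ (*-congˡ (θ-power-suc K n)) ⟩
        θ (partialExp K) n + inv (suc K) * (ν (suc K) * f̂' (power K) n)
          ≈⟨ +-congˡ (solve 3 (λ i v a → i :* (v :* a) := (v :* i) :* a) refl (inv (suc K)) (ν (suc K)) (f̂' (power K) n)) ⟩
        θ (partialExp K) n + (ν (suc K) * inv (suc K)) * f̂' (power K) n
          ≈⟨ +-congˡ (trans (*-congʳ (inv-suc K)) (sym (f'.mul-* (inv K) (power K) n))) ⟩
        θ (partialExp K) n + f̂' (λ m → inv K * power K m) n
          ≈⟨ +-congˡ (f'.mul-cong (λ m → *-comm (inv K) (power K m)) n) ⟩
        θ (partialExp K) n + f̂' (λ m → power K m * inv K) n
          ≈⟨ last K ⟩
        f̂' (partialExp K) n ∎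
        where
        last : ∀ K → θ (partialExp K) n + f̂' (λ m → power K m * inv K) n ≈ f̂' (partialExp K) n
        last zero = trans (+-congʳ (trans (sym (*-assoc (ν n) (power 0 n) (inv 0)))
          (trans (*-congʳ (θ-power-0 n)) (zeroˡ (inv 0))))) (+-identityˡ _)
        last (suc K) = trans (+-congʳ (θ-partialExp K n))
          (sym (f'.mul-+ (partialExp K) (λ m → power (suc K) m * inv (suc K)) n))

      θ-exp : ∀ n → θ exp n ≈ f̂' exp n
      θ-exp n = begin
        -- One term is added first, since `θ-partialExp` takes one away.
        ν n * exp n                      ≈⟨ *-congˡ (partialExp≈exp (suc n) n (ℕₚ.n≤1+n n)) ⟨
        θ (partialExp (suc n)) n         ≈⟨ θ-partialExp n n ⟩
        f̂' (partialExp n) n              ≈⟨ f'.agree-mul (partialExp≈exp n) n ℕₚ.≤-refl ⟩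
        f̂' exp n ∎

      -- shifted j m is the coefficient of zᵐ in z²ʲ exp f.
      shifted : ℕ → ℕ → Carrier
      shifted zero    = exp
      shifted (suc j) = σ (σ (shifted j))

      θ-shifted : ∀ j n → θ (shifted j) n ≈ (2# * ν j) * shifted j n + f̂' (shifted j) n
      θ-shifted zero n = trans (θ-exp n)
        (solve 2 (λ e r → r := ((con 1 :+ con 1) :* con 0) :* e :+ r) refl (exp n) (f̂' exp n))
      θ-shifted (suc j) n = begin
        θ (σ (σ g)) n
          ≈⟨ θ-σ² g n ⟩
        σ (σ (θ g)) n + 2# * σ (σ g) n
          ≈⟨ +-congʳ (trans (σ-cong (σ-cong (θ-shifted j)) n)
               (trans (σ-cong (σ-+ (λ m → t * g m) (f̂' g)) n) (σ-+ (σ (λ m → t * g m)) (σ (f̂' g)) n))) ⟩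
        (σ (σ (λ m → t * g m)) n + σ (σ (f̂' g)) n) + 2# * σ (σ g) n
          ≈⟨ +-congʳ (+-cong (trans (σ-cong (σ-* t g) n) (σ-* t (σ g) n)) (f'.σ²-mul g n)) ⟩
        (t * σ (σ g) n + f̂' (σ (σ g)) n) + 2# * σ (σ g) n
          ≈⟨ solve 3 (λ v a b → (((con 1 :+ con 1) :* v) :* a :+ b) :+ (con 1 :+ con 1) :* a
                 := ((con 1 :+ con 1) :* (con 1 :+ v)) :* a :+ b) refl (ν j) (σ (σ g) n) (f̂' (σ (σ g)) n) ⟩
        (2# * ν (suc j)) * σ (σ g) n + f̂' (σ (σ g)) n ∎
        where
        g = shifted j
        t = 2# * ν j

      open Moments α (2# * β)

      -- In `θ-shifted` at index n+2, the factor z² lowers the index to n, z⁴ also raises j by one,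
      -- and for j > 0 the term from differentiating z²ʲ is read at j - 1. Together these are twice
      -- `raise`.
      shifted-rec : ∀ j n → ν (suc (suc n)) * shifted j (suc (suc n)) ≈ x * shifted j (suc n) + 2# * raise (λ i → shifted i n) j
      shifted-rec zero n = trans (θ-shifted 0 (suc (suc n)))
        (solve 7 (λ x α β a b c d →
            let two = con 1 :+ con 1 in
            (two :* con 0) :* d :+ (x :* a :+ ((two :* α) :* b :+ (two :* (two :* β)) :* c))
              := x :* a :+ two :* (α :* b :+ (two :* β) :* c)) refl
          x α β (exp (suc n)) (exp n) (shifted 1 n) (exp (suc (suc n))))
      shifted-rec (suc j) n = trans (θ-shifted (suc j) (suc (suc n)))
        (solve 8 (λ x α β v a b c d →
            let two = con 1 :+ con 1 in
            (two :* v) :* d :+ (x :* a :+ ((two :* α) :* b :+ (two :* (two :* β)) :* c))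
              := x :* a :+ two :* (v :* d :+ (α :* b :+ (two :* β) :* c))) refl
          x α β (ν (suc j)) (shifted (suc j) (suc n)) (shifted (suc j) n) (shifted (suc (suc j)) n) (shifted j n))

      exp-0 : exp 0 ≈ 1#
      exp-0 = trans (*-cong power-0-0 inv-0) (*-identityˡ 1#)

      exp-1 : exp 1 ≈ x
      exp-1 = begin
        exp 1                ≈⟨ solve 1 (λ e → e := (con 1 :+ con 0) :* e) refl (exp 1) ⟩
        θ exp 1              ≈⟨ θ-exp 1 ⟩
        f̂' exp 1             ≈⟨ solve 4 (λ x α β e → x :* e :+ (α :* con 0 :+ β :* con 0) := x :* e) refl x (2# * α) (2# * (2# * β)) (exp 0) ⟩
        x * exp 0            ≈⟨ *-congˡ exp-0 ⟩
        x * 1#               ≈⟨ *-identityʳ x ⟩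
        x ∎

      -- At j = 0 the moment is a multiple of `exp m`, so a vanishing coefficient would contradict
      -- `stable⇒moment≉0`.
      exp≉0 : StabilityForm (x * x) α (2# * β) → ∀ m → ¬ exp m ≈ 0#
      exp≉0 S m = parity m
        where
        open Stability S
        open Continuants (x * x)
        moment-even' = moment-even x shifted exp-0 (λ _ → refl) exp-1 (λ _ → refl) shifted-rec
        moment-odd'  = moment-odd x shifted exp-0 (λ _ → refl) exp-1 (λ _ → refl) shifted-rec
        even≉0 : ∀ k → ¬ exp (double k) ≈ 0#
        even≉0 k e≈0 = stable⇒moment≉0 (even k) (stable-even k)
          (trans (moment-even' k 0) (trans (*-identityˡ _) (trans (*-congˡ e≈0) (zeroʳ _))))
        odd≉0 : ∀ k → ¬ exp (suc (double k)) ≈ 0#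
        odd≉0 k e≈0 = stable⇒moment≉0 (odd k) (stable-odd k)
          (trans (moment-odd' k 0) (trans (*-congˡ (trans (*-congˡ e≈0) (zeroʳ _))) (zeroʳ x)))
        parity : ∀ m → ¬ exp m ≈ 0#
        parity m with halve m
        ... | k , inj₁ ≡.refl = even≉0 k
        ... | k , inj₂ ≡.refl = odd≉0 k

open import Defs
open +-*-Solver using (solve; _:=_; _:+_; _:*_; _:-_; :-_; con)

-- Rational estimates

0<p*q : ∀ {p q} → 0ℚ ℚ.< p → 0ℚ ℚ.< q → 0ℚ ℚ.< p ℚ.* q
0<p*q {p} {q} 0<p 0<q =
  ℚₚ.positive⁻¹ (p ℚ.* q) {{ℚₚ.pos*pos⇒pos p {{positive 0<p}} q {{positive 0<q}}}}

0<½*p : ∀ {p} → 0ℚ ℚ.< p → 0ℚ ℚ.< ½ ℚ.* p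
0<½*p = 0<p*q (ℚₚ.positive⁻¹ ½)

½*p+½*p : ∀ p → ½ ℚ.* p ℚ.+ ½ ℚ.* p ≡ p
½*p+½*p p = ≡.trans (≡.sym (ℚₚ.*-distribʳ-+ p ½ ½)) (ℚₚ.*-identityˡ p)

p≤∣p∣ : ∀ p → p ℚ.≤ ∣ p ∣
p≤∣p∣ p with ℚₚ.≤-total 0ℚ p
... | inj₁ 0≤p = ℚₚ.≤-reflexive (≡.sym (ℚₚ.0≤p⇒∣p∣≡p 0≤p))
... | inj₂ p≤0 = ℚₚ.≤-trans p≤0 (ℚₚ.0≤∣p∣ p)

∣p-q∣≡∣q-p∣ : ∀ p q → ∣ p ℚ.- q ∣ ≡ ∣ q ℚ.- p ∣
∣p-q∣≡∣q-p∣ p q = ≡.trans (≡.cong ∣_∣ (solve 2 (λ p q → p :- q := :- (q :- p)) ≡.refl p q)) (ℚₚ.∣-p∣≡∣p∣ (q ℚ.- p))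

∣p-q∣<r⇒p<q+r : ∀ p q {r} → ∣ p ℚ.- q ∣ ℚ.< r → p ℚ.< q ℚ.+ r
∣p-q∣<r⇒p<q+r p q {r} h = begin-strict
  p                    ≡⟨ solve 2 (λ p q → p := q :+ (p :- q)) ≡.refl p q ⟩
  q ℚ.+ (p ℚ.- q)      ≤⟨ ℚₚ.+-monoʳ-≤ q (p≤∣p∣ (p ℚ.- q)) ⟩
  q ℚ.+ ∣ p ℚ.- q ∣    <⟨ ℚₚ.+-monoʳ-< q h ⟩
  q ℚ.+ r ∎
  where open ℚₚ.≤-Reasoning

r+r<q+r⇒r<q : ∀ q r → r ℚ.+ r ℚ.< q ℚ.+ r → r ℚ.< q
r+r<q+r⇒r<q q r h = ≡.subst₂ ℚ._<_ (cancel r r) (cancel q r) (ℚₚ.+-monoˡ-< (ℚ.- r) h)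
  where
  cancel : ∀ q r → (q ℚ.+ r) ℚ.- r ≡ q
  cancel = solve 2 (λ q r → (q :+ r) :- r := q) ≡.refl

ε≤p⇒½*ε<q : ∀ {ε} p q → ε ℚ.≤ p → ∣ p ℚ.- q ∣ ℚ.< ½ ℚ.* ε → ½ ℚ.* ε ℚ.< q
ε≤p⇒½*ε<q {ε} p q ε≤p h = r+r<q+r⇒r<q q (½ ℚ.* ε) (begin-strict
  ½ ℚ.* ε ℚ.+ ½ ℚ.* ε    ≡⟨ ½*p+½*p ε ⟩
  ε                      ≤⟨ ε≤p ⟩
  p                      <⟨ ∣p-q∣<r⇒p<q+r p q h ⟩
  q ℚ.+ ½ ℚ.* ε ∎)
  where open ℚₚ.≤-Reasoning

-- Tails of Cauchy sequences

Eventually : (ℕ → Set) → Set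
Eventually P = ∃ λ N → ∀ n → N ℕ.≤ n → P n

eventually-map₂ : ∀ {P Q R : ℕ → Set} → (∀ n → P n → Q n → R n) → Eventually P → Eventually Q → Eventually R
eventually-map₂ f (M , p) (N , q) =
  M ⊔ N , λ n h → f n (p n (ℕₚ.m⊔n≤o⇒m≤o M N h)) (q n (ℕₚ.m⊔n≤o⇒n≤o M N h))

eventually-bounded : ∀ x → ∃ λ B → 0ℚ ℚ.< B × Eventually (λ n → ∣ seq x n ∣ ℚ.< B)
eventually-bounded x = ∣ seq x N ∣ ℚ.+ 1ℚ , 0<B , N , λ n N≤n → begin-strict
    ∣ seq x n ∣                                   ≡⟨ ≡.cong ∣_∣ (solve 2 (λ a b → a := b :+ (a :- b)) ≡.refl (seq x n) (seq x N)) ⟩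
    ∣ seq x N ℚ.+ (seq x n ℚ.- seq x N) ∣         ≤⟨ ℚₚ.∣p+q∣≤∣p∣+∣q∣ (seq x N) (seq x n ℚ.- seq x N) ⟩
    ∣ seq x N ∣ ℚ.+ ∣ seq x n ℚ.- seq x N ∣       <⟨ ℚₚ.+-monoʳ-< ∣ seq x N ∣ (proj₂ tail n N N≤n ℕₚ.≤-refl) ⟩
    ∣ seq x N ∣ ℚ.+ 1ℚ ∎
  where
  open ℚₚ.≤-Reasoning
  tail = cauchy x 1ℚ (ℚₚ.positive⁻¹ 1ℚ)
  N = proj₁ tail
  0<B = ℚₚ.+-mono-≤-< (ℚₚ.0≤∣p∣ (seq x N)) (ℚₚ.positive⁻¹ 1ℚ)

-- Reduces ring identities of reals to identities of rationals at each index, which the solver can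
-- decide.
pointwise : ∀ {x y} → (∀ n → seq x n ≡ seq y n) → x ≈ᵣ y
pointwise {x} {y} eq = mk≈ᵣ λ ε 0<ε → 0 , λ n _ →
  ≡.subst (ℚ._< ε) (≡.sym (≡.cong ∣_∣ (≡.trans (≡.cong (ℚ._- seq y n) (eq n)) (ℚₚ.+-inverseʳ (seq y n))))) 0<ε

≈ᵣ-refl : ∀ {x} → x ≈ᵣ x
≈ᵣ-refl = pointwise λ _ → ≡.refl

≈ᵣ-sym : ∀ {x y} → x ≈ᵣ y → y ≈ᵣ x
≈ᵣ-sym {x} {y} x≈y = mk≈ᵣ λ ε 0<ε → let N , h = close x≈y ε 0<ε in
  N , λ n N≤n → ≡.subst (ℚ._< ε) (∣p-q∣≡∣q-p∣ (seq x n) (seq y n)) (h n N≤n)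

∣p+q∣<ε : ∀ {ε} p q → ∣ p ∣ ℚ.< ½ ℚ.* ε → ∣ q ∣ ℚ.< ½ ℚ.* ε → ∣ p ℚ.+ q ∣ ℚ.< ε
∣p+q∣<ε {ε} p q hp hq = begin-strict
  ∣ p ℚ.+ q ∣               ≤⟨ ℚₚ.∣p+q∣≤∣p∣+∣q∣ p q ⟩
  ∣ p ∣ ℚ.+ ∣ q ∣           <⟨ ℚₚ.+-mono-< hp hq ⟩
  ½ ℚ.* ε ℚ.+ ½ ℚ.* ε       ≡⟨ ½*p+½*p ε ⟩
  ε ∎
  where open ℚₚ.≤-Reasoning

≈ᵣ-trans : ∀ {x y z} → x ≈ᵣ y → y ≈ᵣ z → x ≈ᵣ z
≈ᵣ-trans {x} {y} {z} x≈y y≈z = mk≈ᵣ λ ε 0<ε →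
  eventually-map₂ (λ n h k → ≡.subst (λ t → ∣ t ∣ ℚ.< ε)
             (solve 3 (λ a b c → (a :- b) :+ (b :- c) := a :- c) ≡.refl (seq x n) (seq y n) (seq z n))
             (∣p+q∣<ε (seq x n ℚ.- seq y n) (seq y n ℚ.- seq z n) h k))
    (close x≈y (½ ℚ.* ε) (0<½*p 0<ε)) (close y≈z (½ ℚ.* ε) (0<½*p 0<ε))

infixl 6 _⊞_
infixl 7 _⊠_
infix  8 ⊟_

-- Copies of the field operations that do not unfold, so that comparing real expressions never compares
-- the Cauchy moduli inside them.
opaque
  _⊞_ _⊠_ : ℝ → ℝ → ℝ
  x ⊞ y = x +ᵣ y
  x ⊠ y = x *ᵣ y

  ⊟_ : ℝ → ℝ
  ⊟ x = -ᵣ x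

opaque
  unfolding _⊞_ _⊠_ ⊟_

  +ᵣ≡⊞ : ∀ x y → x +ᵣ y ≡ x ⊞ y
  +ᵣ≡⊞ x y = ≡.refl

  *ᵣ≡⊠ : ∀ x y → x *ᵣ y ≡ x ⊠ y
  *ᵣ≡⊠ x y = ≡.refl

  -ᵣ≡⊟ : ∀ x → -ᵣ x ≡ ⊟ x
  -ᵣ≡⊟ x = ≡.refl

  ⊞-cong : ∀ {x y u v} → x ≈ᵣ y → u ≈ᵣ v → x ⊞ u ≈ᵣ y ⊞ v
  ⊞-cong {x} {y} {u} {v} x≈y u≈v = mk≈ᵣ λ ε 0<ε →
    eventually-map₂ (λ n h k → ≡.subst (λ t → ∣ t ∣ ℚ.< ε)
               (solve 4 (λ a b c d → (a :- b) :+ (c :- d) := (a :+ c) :- (b :+ d)) ≡.refl (seq x n) (seq y n) (seq u n) (seq v n))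
               (∣p+q∣<ε (seq x n ℚ.- seq y n) (seq u n ℚ.- seq v n) h k))
      (close x≈y (½ ℚ.* ε) (0<½*p 0<ε)) (close u≈v (½ ℚ.* ε) (0<½*p 0<ε))

  ⊟-cong : ∀ {x y} → x ≈ᵣ y → ⊟ x ≈ᵣ ⊟ y
  ⊟-cong {x} {y} x≈y = mk≈ᵣ λ ε 0<ε → let N , h = close x≈y ε 0<ε in N , λ n N≤n →
    ≡.subst (ℚ._< ε) (≡.trans (∣p-q∣≡∣q-p∣ (seq x n) (seq y n))
      (≡.cong ∣_∣ (solve 2 (λ a b → b :- a := (:- a) :- (:- b)) ≡.refl (seq x n) (seq y n)))) (h n N≤n)

quotient : ∀ ε B → 0ℚ ℚ.< ε → 0ℚ ℚ.< B → ∃ λ δ → 0ℚ ℚ.< δ × δ ℚ.* B ≡ ε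
quotient ε B 0<ε 0<B = ε ℚ.* i , 0<p*q 0<ε 0<i , εiB≡ε
  where
  instance
    nzB : ℚ.NonZero B
    nzB = ℚₚ.pos⇒nonZero B {{positive 0<B}}
  i = 1/ B
  0<i : 0ℚ ℚ.< i
  0<i = ℚₚ.positive⁻¹ i {{ℚₚ.1/pos⇒pos B {{positive 0<B}}}}
  εiB≡ε : ε ℚ.* i ℚ.* B ≡ ε
  εiB≡ε = ≡.trans (ℚₚ.*-assoc ε i B) (≡.trans (≡.cong (ε ℚ.*_) (ℚₚ.*-inverseˡ B)) (ℚₚ.*-identityʳ ε))

∣pr-qr∣<δB : ∀ p q r {δ B} → 0ℚ ℚ.< B → ∣ p ℚ.- q ∣ ℚ.< δ → ∣ r ∣ ℚ.< B →
             ∣ p ℚ.* r ℚ.- q ℚ.* r ∣ ℚ.< δ ℚ.* B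
∣pr-qr∣<δB p q r {δ} {B} 0<B p-q<δ r<B = begin-strict
  ∣ p ℚ.* r ℚ.- q ℚ.* r ∣    ≡⟨ ≡.cong ∣_∣ (solve 3 (λ p q r → p :* r :- q :* r := (p :- q) :* r) ≡.refl p q r) ⟩
  ∣ (p ℚ.- q) ℚ.* r ∣        ≡⟨ ℚₚ.∣p*q∣≡∣p∣*∣q∣ (p ℚ.- q) r ⟩
  ∣ p ℚ.- q ∣ ℚ.* ∣ r ∣      ≤⟨ ℚₚ.*-monoˡ-≤-nonNeg ∣ p ℚ.- q ∣ {{nonNegative (ℚₚ.0≤∣p∣ (p ℚ.- q))}} (ℚₚ.<⇒≤ r<B) ⟩
  ∣ p ℚ.- q ∣ ℚ.* B          <⟨ ℚₚ.*-monoˡ-<-pos B {{positive 0<B}} p-q<δ ⟩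
  δ ℚ.* B ∎
  where open ℚₚ.≤-Reasoning

opaque
  unfolding _⊞_ _⊠_ ⊟_

  ⊠-congʳ : ∀ {x y} z → x ≈ᵣ y → x ⊠ z ≈ᵣ y ⊠ z
  ⊠-congʳ {x} {y} z x≈y = mk≈ᵣ λ ε 0<ε →
    let B , 0<B , z<B   = eventually-bounded z
        δ , 0<δ , δB≡ε  = quotient ε B 0<ε 0<B
    in *-close {ε} {δ} {B} 0<B δB≡ε (close x≈y δ 0<δ) z<B
    where
    *-close : ∀ {ε δ B} → 0ℚ ℚ.< B → δ ℚ.* B ≡ ε →
      Eventually (λ n → ∣ seq x n ℚ.- seq y n ∣ ℚ.< δ) → Eventually (λ n → ∣ seq z n ∣ ℚ.< B) →
      Eventually (λ n → ∣ seq x n ℚ.* seq z n ℚ.- seq y n ℚ.* seq z n ∣ ℚ.< ε)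
    *-close 0<B ≡.refl = eventually-map₂ λ n → ∣pr-qr∣<δB (seq x n) (seq y n) (seq z n) 0<B

  ⊠-comm : ∀ x y → x ⊠ y ≈ᵣ y ⊠ x
  ⊠-comm x y = pointwise λ n → ℚₚ.*-comm (seq x n) (seq y n)

⊠-cong : ∀ {x y u v} → x ≈ᵣ y → u ≈ᵣ v → x ⊠ u ≈ᵣ y ⊠ v
⊠-cong {x} {y} {u} {v} x≈y u≈v =
  ≈ᵣ-trans (⊠-congʳ u x≈y) (≈ᵣ-trans (⊠-comm y u) (≈ᵣ-trans (⊠-congʳ y u≈v) (⊠-comm v y)))

-- The order on the reals

record Pos (x : ℝ) : Set where
  constructor mkPos
  field
    bound : ∃ λ ε → 0ℚ ℚ.< ε × Eventually (λ n → ε ℚ.< seq x n)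

-- A disjunction, so that closure under sums and products follows by cases without excluded middle.
NonNeg : ℝ → Set
NonNeg x = Pos x ⊎ x ≈ᵣ 0ᵣ

Pos-resp : ∀ {x y} → x ≈ᵣ y → Pos x → Pos y
Pos-resp {x} {y} x≈y (mkPos (ε , 0<ε , ε<x)) = mkPos (½ ℚ.* ε , 0<½*p 0<ε ,
  eventually-map₂ (λ n h k → ε≤p⇒½*ε<q (seq x n) (seq y n) (ℚₚ.<⇒≤ h) k) ε<x (close x≈y (½ ℚ.* ε) (0<½*p 0<ε)))

¬Pos-0 : ¬ Pos 0ᵣ
¬Pos-0 (mkPos (ε , 0<ε , N , ε<0)) = ℚₚ.<-asym 0<ε (ε<0 N ℕₚ.≤-refl)

Pos⇒≉0 : ∀ {x} → Pos x → ¬ (x ≈ᵣ 0ᵣ)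
Pos⇒≉0 px x≈0 = ¬Pos-0 (Pos-resp x≈0 px)

opaque
  unfolding _⊞_ _⊠_ ⊟_

  Pos-⊞ : ∀ {x y} → Pos x → Pos y → Pos (x ⊞ y)
  Pos-⊞ (mkPos (ε , 0<ε , hx)) (mkPos (δ , 0<δ , hy)) =
    mkPos (ε ℚ.+ δ , ℚₚ.+-mono-< 0<ε 0<δ , eventually-map₂ (λ n → ℚₚ.+-mono-<) hx hy)

  Pos-⊠ : ∀ {x y} → Pos x → Pos y → Pos (x ⊠ y)
  Pos-⊠ {x} {y} (mkPos (ε , 0<ε , hx)) (mkPos (δ , 0<δ , hy)) = mkPos (ε ℚ.* δ , 0<p*q 0<ε 0<δ ,
    eventually-map₂ (λ n h k → ℚₚ.<-trans
        (ℚₚ.*-monoˡ-<-pos δ {{positive 0<δ}} h)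
        (ℚₚ.*-monoʳ-<-pos (seq x n) {{positive (ℚₚ.<-trans 0<ε h)}} k))
      hx hy)

ε≤x⇒Pos : ∀ x {ε} N n → 0ℚ ℚ.< ε → (∀ m n → N ℕ.≤ m → N ℕ.≤ n → ∣ seq x m ℚ.- seq x n ∣ ℚ.< ½ ℚ.* ε) →
           N ℕ.≤ n → ε ℚ.≤ seq x n → Pos x
ε≤x⇒Pos x {ε} N n 0<ε h N≤n ε≤x = mkPos (½ ℚ.* ε , 0<½*p 0<ε , N , λ k N≤k →
  ε≤p⇒½*ε<q (seq x n) (seq x k) ε≤x (h n k N≤n N≤k))

-- If |x n| ≥ ε at one index of a tail that varies by less than ε/2, the whole tail keeps that sign
-- and stays more than ε/2 away from 0.
¬Pos⇒≈0 : ∀ x → ¬ Pos x → ¬ Pos (-ᵣ x) → x ≈ᵣ 0ᵣ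
¬Pos⇒≈0 x ¬px ¬nx = mk≈ᵣ close-0
  where
  close-0 : ∀ ε → 0ℚ ℚ.< ε → Eventually (λ n → ∣ seq x n ℚ.- 0ℚ ∣ ℚ.< ε)
  close-0 ε 0<ε = N , λ n N≤n → ≡.subst (λ t → ∣ t ∣ ℚ.< ε) (≡.sym (ℚₚ.+-identityʳ (seq x n))) (small n N≤n)
    where
    N = proj₁ (cauchy x (½ ℚ.* ε) (0<½*p 0<ε))
    h = proj₂ (cauchy x (½ ℚ.* ε) (0<½*p 0<ε))
    -h : ∀ m n → N ℕ.≤ m → N ℕ.≤ n → ∣ (ℚ.- seq x m) ℚ.- (ℚ.- seq x n) ∣ ℚ.< ½ ℚ.* ε
    -h m n p q = ≡.subst (ℚ._< ½ ℚ.* ε)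
      (≡.cong ∣_∣ (solve 2 (λ a b → b :- a := (:- a) :- (:- b)) ≡.refl (seq x m) (seq x n))) (h n m q p)
    small : ∀ n → N ℕ.≤ n → ∣ seq x n ∣ ℚ.< ε
    small n N≤n with ∣ seq x n ∣ ℚ.<? ε
    ... | yes lt = lt
    ... | no ≮ with ℚₚ.∣p∣≡p∨∣p∣≡-p (seq x n)
    ...   | inj₁ eq = ⊥-elim (¬px (ε≤x⇒Pos x N n 0<ε h N≤n (≡.subst (ε ℚ.≤_) eq (ℚₚ.≮⇒≥ ≮))))
    ...   | inj₂ eq = ⊥-elim (¬nx (ε≤x⇒Pos (-ᵣ x) N n 0<ε -h N≤n (≡.subst (ε ℚ.≤_) eq (ℚₚ.≮⇒≥ ≮))))

trichotomy : ExcludedMiddle 0ℓ → ∀ x → Pos x ⊎ x ≈ᵣ 0ᵣ ⊎ Pos (⊟ x)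
trichotomy em x with em {P = Pos x} | em {P = Pos (-ᵣ x)}
... | yes px | _      = inj₁ px
... | no _   | yes nx = inj₂ (inj₂ (≡.subst Pos (-ᵣ≡⊟ x) nx))
... | no ¬px | no ¬nx = inj₂ (inj₁ (¬Pos⇒≈0 x ¬px ¬nx))

-- The complex numbers as a commutative semiring

≈-isEquivalence : IsEquivalence _≈_
≈-isEquivalence = record
  { refl  = ≈ᵣ-refl , ≈ᵣ-refl
  ; sym   = λ (p , q) → ≈ᵣ-sym p , ≈ᵣ-sym q
  ; trans = λ (p , q) (p' , q') → ≈ᵣ-trans p p' , ≈ᵣ-trans q q'
  }

infixl 6 _+ᶜ_
infixl 7 _*ᶜ_

_+ᶜ_ _*ᶜ_ : ℂ → ℂ → ℂ
z +ᶜ w = (re z ⊞ re w) +i (im z ⊞ im w)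
z *ᶜ w = (re z ⊠ re w ⊞ ⊟ (im z ⊠ im w)) +i (re z ⊠ im w ⊞ im z ⊠ re w)

ℂ-+-cong : ∀ {x y u v} → x ≈ y → u ≈ v → x +ᶜ u ≈ y +ᶜ v
ℂ-+-cong (p , q) (p' , q') = ⊞-cong p p' , ⊞-cong q q'

ℂ-*-cong : ∀ {x y u v} → x ≈ y → u ≈ v → x *ᶜ u ≈ y *ᶜ v
ℂ-*-cong (p , q) (p' , q') =
    ⊞-cong (⊠-cong p p') (⊟-cong (⊠-cong q q'))
  , ⊞-cong (⊠-cong p q') (⊠-cong q p')

opaque
  unfolding _⊞_ _⊠_ ⊟_

  ℂ-*-assoc : ∀ x y z → (x *ᶜ y) *ᶜ z ≈ x *ᶜ (y *ᶜ z)
  ℂ-*-assoc x y z =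
      pointwise (λ n → solve 6 (λ a b c d e f →
          (a :* c :+ :- (b :* d)) :* e :+ :- ((a :* d :+ b :* c) :* f) := a :* (c :* e :+ :- (d :* f)) :+ :- (b :* (c :* f :+ d :* e)))
        ≡.refl (seq (re x) n) (seq (im x) n) (seq (re y) n) (seq (im y) n) (seq (re z) n) (seq (im z) n))
    , pointwise (λ n → solve 6 (λ a b c d e f →
          (a :* c :+ :- (b :* d)) :* f :+ (a :* d :+ b :* c) :* e := a :* (c :* f :+ d :* e) :+ b :* (c :* e :+ :- (d :* f)))
        ≡.refl (seq (re x) n) (seq (im x) n) (seq (re y) n) (seq (im y) n) (seq (re z) n) (seq (im z) n))

  ℂ-distribʳ : ∀ x y z → (y +ᶜ z) *ᶜ x ≈ y *ᶜ x +ᶜ z *ᶜ x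
  ℂ-distribʳ x y z =
      pointwise (λ n → solve 6 (λ a b c d e f →
          (c :+ e) :* a :+ :- ((d :+ f) :* b) := (c :* a :+ :- (d :* b)) :+ (e :* a :+ :- (f :* b)))
        ≡.refl (seq (re x) n) (seq (im x) n) (seq (re y) n) (seq (im y) n) (seq (re z) n) (seq (im z) n))
    , pointwise (λ n → solve 6 (λ a b c d e f →
          (c :+ e) :* b :+ (d :+ f) :* a := (c :* b :+ d :* a) :+ (e :* b :+ f :* a))
        ≡.refl (seq (re x) n) (seq (im x) n) (seq (re y) n) (seq (im y) n) (seq (re z) n) (seq (im z) n))

  ℂ-*-comm : ∀ x y → x *ᶜ y ≈ y *ᶜ x
  ℂ-*-comm x y =
      pointwise (λ n → solve 4 (λ a b c d → a :* c :+ :- (b :* d) := c :* a :+ :- (d :* b))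
        ≡.refl (seq (re x) n) (seq (im x) n) (seq (re y) n) (seq (im y) n))
    , pointwise (λ n → solve 4 (λ a b c d → a :* d :+ b :* c := c :* b :+ d :* a)
        ≡.refl (seq (re x) n) (seq (im x) n) (seq (re y) n) (seq (im y) n))

  ℂ-*-identityˡ : ∀ x → 1ᶜ *ᶜ x ≈ x
  ℂ-*-identityˡ x =
      pointwise (λ n → solve 2 (λ a b → con 1ℚ :* a :+ :- (con 0ℚ :* b) := a) ≡.refl (seq (re x) n) (seq (im x) n))
    , pointwise (λ n → solve 2 (λ a b → con 1ℚ :* b :+ con 0ℚ :* a := b) ≡.refl (seq (re x) n) (seq (im x) n))

  ℂ-zeroˡ : ∀ x → 0ᶜ *ᶜ x ≈ 0ᶜ
  ℂ-zeroˡ x =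
      pointwise (λ n → solve 2 (λ a b → con 0ℚ :* a :+ :- (con 0ℚ :* b) := con 0ℚ) ≡.refl (seq (re x) n) (seq (im x) n))
    , pointwise (λ n → solve 2 (λ a b → con 0ℚ :* b :+ con 0ℚ :* a := con 0ℚ) ≡.refl (seq (re x) n) (seq (im x) n))

  ℂ-+-assoc : ∀ x y z → (x +ᶜ y) +ᶜ z ≈ x +ᶜ (y +ᶜ z)
  ℂ-+-assoc x y z = pointwise (λ n → ℚₚ.+-assoc (seq (re x) n) (seq (re y) n) (seq (re z) n))
                  , pointwise (λ n → ℚₚ.+-assoc (seq (im x) n) (seq (im y) n) (seq (im z) n))

  ℂ-+-identityˡ : ∀ x → 0ᶜ +ᶜ x ≈ x
  ℂ-+-identityˡ x = pointwise (λ n → ℚₚ.+-identityˡ (seq (re x) n)) , pointwise (λ n → ℚₚ.+-identityˡ (seq (im x) n))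

  ℂ-+-comm : ∀ x y → x +ᶜ y ≈ y +ᶜ x
  ℂ-+-comm x y = pointwise (λ n → ℚₚ.+-comm (seq (re x) n) (seq (re y) n))
               , pointwise (λ n → ℚₚ.+-comm (seq (im x) n) (seq (im y) n))

ℂ-commutativeSemiring : CommutativeSemiring 0ℓ 0ℓ
ℂ-commutativeSemiring = record
  { Carrier = ℂ ; _≈_ = _≈_ ; _+_ = _+ᶜ_ ; _*_ = _*ᶜ_ ; 0# = 0ᶜ ; 1# = 1ᶜ
  ; isCommutativeSemiring = isCommutativeSemiringˡ record
    { +-isCommutativeMonoid = isCommutativeMonoidˡ record
      { isSemigroup = record
        { isMagma = record { isEquivalence = ≈-isEquivalence ; ∙-cong = ℂ-+-cong }
        ; assoc   = ℂ-+-assoc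
        }
      ; identityˡ = ℂ-+-identityˡ
      ; comm      = ℂ-+-comm
      }
    ; *-isCommutativeMonoid = isCommutativeMonoidˡ record
      { isSemigroup = record
        { isMagma = record { isEquivalence = ≈-isEquivalence ; ∙-cong = ℂ-*-cong }
        ; assoc   = ℂ-*-assoc
        }
      ; identityˡ = ℂ-*-identityˡ
      ; comm      = ℂ-*-comm
      }
    ; distribʳ = ℂ-distribʳ
    ; zeroˡ    = ℂ-zeroˡ
    }
  }

open MultiAffinePolynomials ℂ-commutativeSemiring using (ν; StabilityForm)
open ExponentialSeries ℂ-commutativeSemiring using (convolution; module Multiplication; module Exponential) renaming (sum to ∑)
open CommutativeSemiring ℂ-commutativeSemiring using (refl; sym; trans; reflexive; *-congʳ; zeroˡ)

-- Natural numbers and reciprocal factorials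

natℚ : ℕ → ℚ
natℚ zero    = 0ℚ
natℚ (suc n) = 1ℚ ℚ.+ natℚ n

toℚᵘ-natℚ : ∀ n → toℚᵘ (natℚ n) ℚᵘ.≃ mkℚᵘ (+ n) 0
toℚᵘ-natℚ zero    = ℚᵘₚ.≃-refl
toℚᵘ-natℚ (suc n) = ℚᵘₚ.≃-trans (ℚₚ.toℚᵘ-homo-+ 1ℚ (natℚ n))
  (ℚᵘₚ.≃-trans (ℚᵘₚ.+-congʳ (toℚᵘ 1ℚ) (toℚᵘ-natℚ n))
    (*≡* (≡.cong (λ i → (+ 1 ℤ.+ i) ℤ.* + 1) (ℤₚ.*-identityʳ (+ n)))))

-- `_/_` reduces to lowest terms, so the cancellation is done by cross-multiplying unnormalised
-- fractions.
natℚ*1/ : ∀ m n .{{_ : ℕ.NonZero n}} → natℚ (suc m) ℚ.* (+ 1 / (suc m ℕ.* n)) {{ℕₚ.m*n≢0 (suc m) n}} ≡ + 1 / n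
natℚ*1/ m (suc n) = ℚₚ.toℚᵘ-injective
  (ℚᵘₚ.≃-trans (ℚₚ.toℚᵘ-homo-* (natℚ (suc m)) (+ 1 / d))
  -- `mkℚᵘ` stores the denominator minus one, here d - 1.
  (ℚᵘₚ.≃-trans (ℚᵘₚ.*-cong (toℚᵘ-natℚ (suc m)) (ℚₚ.toℚᵘ-fromℚᵘ (mkℚᵘ (+ 1) (n ℕ.+ m ℕ.* suc n))))
  (ℚᵘₚ.≃-trans (*≡* cross) (ℚᵘₚ.≃-sym (ℚₚ.toℚᵘ-fromℚᵘ (mkℚᵘ (+ 1) n))))))
  where
  d = suc m ℕ.* suc n
  cross : (+ suc m ℤ.* + 1) ℤ.* + suc n ≡ + 1 ℤ.* (+ suc (n ℕ.+ m ℕ.* suc n ℕ.+ 0))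
  cross = ≡.trans (≡.cong (ℤ._* + suc n) (ℤₚ.*-identityʳ (+ suc m)))
         (≡.trans (≡.sym (ℤₚ.pos-* (suc m) (suc n)))
         (≡.trans (≡.cong +_ (≡.sym (ℕₚ.+-identityʳ d))) (≡.sym (ℤₚ.*-identityˡ (+ (d ℕ.+ 0))))))

1/! : ℕ → ℂ
1/! n = fromℝ (fromℚ ((+ 1 / (n !)) {{n ℕₚ.!≢0}}))

opaque
  unfolding _⊞_ _⊠_ ⊟_

  seq-re-ν : ∀ n i → seq (re (ν n)) i ≡ natℚ n
  seq-re-ν zero    i = ≡.refl
  seq-re-ν (suc n) i = ≡.cong (1ℚ ℚ.+_) (seq-re-ν n i)

  seq-im-ν : ∀ n i → seq (im (ν n)) i ≡ 0ℚ
  seq-im-ν zero    i = ≡.refl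
  seq-im-ν (suc n) i = ≡.trans (≡.cong (0ℚ ℚ.+_) (seq-im-ν n i)) (ℚₚ.+-identityˡ 0ℚ)

  ν*1/! : ∀ k → ν (suc k) *ᶜ 1/! (suc k) ≈ 1/! k
  ν*1/! k =
      pointwise (λ i → ≡.trans (≡.cong₂ (λ a b → a ℚ.* r ℚ.- b ℚ.* 0ℚ) (seq-re-ν (suc k) i) (seq-im-ν (suc k) i))
        (≡.trans (solve 1 (λ a → a :- con 0ℚ :* con 0ℚ := a) ≡.refl (natℚ (suc k) ℚ.* r)) (natℚ*1/ k (k !) {{k ℕₚ.!≢0}})))
    , pointwise (λ i → ≡.trans (≡.cong₂ (λ a b → a ℚ.* 0ℚ ℚ.+ b ℚ.* r) (seq-re-ν (suc k) i) (seq-im-ν (suc k) i))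
        (solve 2 (λ a r → a :* con 0ℚ :+ con 0ℚ :* r := con 0ℚ) ≡.refl (natℚ (suc k)) r))
    where
    r : ℚ
    r = (+ 1 / (suc k !)) {{suc k ℕₚ.!≢0}}

0≤natℚ : ∀ n → 0ℚ ℚ.≤ natℚ n
0≤natℚ zero    = ℚₚ.≤-refl
0≤natℚ (suc n) = ℚₚ.+-mono-≤ (ℚₚ.<⇒≤ (ℚₚ.positive⁻¹ 1ℚ)) (0≤natℚ n)

½<natℚ : ∀ n → ½ ℚ.< natℚ (suc n)
½<natℚ n = ℚₚ.+-mono-<-≤ {½} {1ℚ} (ℚ.*<* (ℤ.+<+ (s≤s (s≤s z≤n)))) (0≤natℚ n)

Pos-re-ν : ∀ n → Pos (re (ν (suc n)))
Pos-re-ν n = mkPos (½ , ℚₚ.positive⁻¹ ½ , 0 , λ i _ → ≡.subst (½ ℚ.<_) (≡.sym (seq-re-ν (suc n) i)) (½<natℚ n))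

-- The form Im(X Z̄) and its sign

normSq : ℂ → ℝ
normSq z = re z ⊠ re z ⊞ im z ⊠ im z

-- κ Im(X Z̄). Taking κ = Im w treats Im w > 0 and Im w < 0 alike.
form : ℝ → ℂ → ℂ → ℝ
form κ X Z = κ ⊠ (im X ⊠ re Z ⊞ ⊟ (re X ⊠ im Z))

-ᶜ_ : ℂ → ℂ
-ᶜ z = (⊟ re z) +i (⊟ im z)

opaque
  unfolding _⊞_ _⊠_ ⊟_

  ⊞-identityʳ : ∀ x → x ⊞ 0ᵣ ≈ᵣ x
  ⊞-identityʳ x = pointwise λ n → ℚₚ.+-identityʳ (seq x n)

  ⊞-comm : ∀ x y → x ⊞ y ≈ᵣ y ⊞ x
  ⊞-comm x y = pointwise λ n → ℚₚ.+-comm (seq x n) (seq y n)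

  ⊠-zeroʳ : ∀ x → x ⊠ 0ᵣ ≈ᵣ 0ᵣ
  ⊠-zeroʳ x = pointwise λ n → ℚₚ.*-zeroʳ (seq x n)

  ⊟0≈0 : ⊟ 0ᵣ ≈ᵣ 0ᵣ
  ⊟0≈0 = pointwise λ _ → ≡.refl

  ⊟x⊠⊟x≈x⊠x : ∀ x → ⊟ x ⊠ ⊟ x ≈ᵣ x ⊠ x
  ⊟x⊠⊟x≈x⊠x x = pointwise λ n → solve 1 (λ a → (:- a) :* (:- a) := a :* a) ≡.refl (seq x n)

  ⊠-square : ∀ x y → (x ⊠ x) ⊠ (y ⊠ y) ≈ᵣ (x ⊠ y) ⊠ (x ⊠ y)
  ⊠-square x y = pointwise λ n →
    solve 2 (λ a b → (a :* a) :* (b :* b) := (a :* b) :* (a :* b)) ≡.refl (seq x n) (seq y n)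

  normSq-* : ∀ z w → normSq z ⊠ normSq w ≈ᵣ normSq (z *ᶜ w)
  normSq-* z w = pointwise λ n → solve 4 (λ a b c d → (a :* a :+ b :* b) :* (c :* c :+ d :* d)
      := (a :* c :- b :* d) :* (a :* c :- b :* d) :+ (a :* d :+ b :* c) :* (a :* d :+ b :* c))
    ≡.refl (seq (re z) n) (seq (im z) n) (seq (re w) n) (seq (im w) n)

  form-0ˡ : ∀ κ Z → form κ 0ᶜ Z ≈ᵣ 0ᵣ
  form-0ˡ κ Z = pointwise λ n → solve 3 (λ k c d → k :* (con 0ℚ :* c :- con 0ℚ :* d) := con 0ℚ) ≡.refl
    (seq κ n) (seq (re Z) n) (seq (im Z) n)

  form-0ʳ : ∀ κ X → form κ X 0ᶜ ≈ᵣ 0ᵣ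
  form-0ʳ κ X = pointwise λ n → solve 3 (λ k a b → k :* (b :* con 0ℚ :- a :* con 0ℚ) := con 0ℚ) ≡.refl
    (seq κ n) (seq (re X) n) (seq (im X) n)

  form-+ˡ : ∀ κ X Y Z → form κ X Z ⊞ form κ Y Z ≈ᵣ form κ (X +ᶜ Y) Z
  form-+ˡ κ X Y Z = pointwise λ n → solve 7 (λ k a b c d e f →
      k :* (b :* e :- a :* f) :+ k :* (d :* e :- c :* f) := k :* ((b :+ d) :* e :- (a :+ c) :* f)) ≡.refl
    (seq κ n) (seq (re X) n) (seq (im X) n) (seq (re Y) n) (seq (im Y) n) (seq (re Z) n) (seq (im Z) n)

  form-+ʳ : ∀ κ X Y Z → form κ X Y ⊞ form κ X Z ≈ᵣ form κ X (Y +ᶜ Z)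
  form-+ʳ κ X Y Z = pointwise λ n → solve 7 (λ k a b c d e f →
      k :* (b :* c :- a :* d) :+ k :* (b :* e :- a :* f) := k :* (b :* (c :+ e) :- a :* (d :+ f))) ≡.refl
    (seq κ n) (seq (re X) n) (seq (im X) n) (seq (re Y) n) (seq (im Y) n) (seq (re Z) n) (seq (im Z) n)

  form-scale : ∀ κ t X Z → normSq t ⊠ form κ X Z ≈ᵣ form κ (t *ᶜ X) (t *ᶜ Z)
  form-scale κ t X Z = pointwise λ n → solve 7 (λ k r s a b c d →
      (r :* r :+ s :* s) :* (k :* (b :* c :- a :* d))
        := k :* ((r :* b :+ s :* a) :* (r :* c :- s :* d) :- (r :* a :- s :* b) :* (r :* d :+ s :* c))) ≡.refl
    (seq κ n) (seq (re t) n) (seq (im t) n) (seq (re X) n) (seq (im X) n) (seq (re Z) n) (seq (im Z) n)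

  -- Im(w Z Z̄) = Im w · |Z|², and the choice κ = Im w turns the factor Im w into a square.
  form-im : ∀ w Z → (im w ⊠ im w) ⊠ normSq Z ≈ᵣ form (im w) (w *ᶜ Z) Z
  form-im w Z = pointwise λ n → solve 4 (λ a b c d →
      (b :* b) :* (c :* c :+ d :* d) := b :* ((a :* d :+ b :* c) :* c :- (a :* c :- b :* d) :* d)) ≡.refl
    (seq (re w) n) (seq (im w) n) (seq (re Z) n) (seq (im Z) n)

  form-real : ∀ κ α Z → form κ (fromℝ α *ᶜ Z) Z ≈ᵣ 0ᵣ
  form-real κ α Z = pointwise λ n → solve 4 (λ k a c d →
      k :* ((a :* d :+ con 0ℚ :* c) :* c :- (a :* c :- con 0ℚ :* d) :* d) := con 0ℚ) ≡.refl
    (seq κ n) (seq α n) (seq (re Z) n) (seq (im Z) n)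

  -- The form is antisymmetric and 2β is real; the coefficient on the left is positive exactly
  -- because β < 0.
  form-swap : ∀ κ β Y Z → (⊟ β ⊞ ⊟ β) ⊠ form κ Z Y ≈ᵣ form κ ((1ᶜ +ᶜ 1ᶜ) *ᶜ fromℝ β *ᶜ Y) Z
  form-swap κ β Y Z = pointwise λ n → solve 6 (λ k e a b c d →
      let re-γ = (con 1ℚ :+ con 1ℚ) :* e :- (con 0ℚ :+ con 0ℚ) :* con 0ℚ
          im-γ = (con 1ℚ :+ con 1ℚ) :* con 0ℚ :+ (con 0ℚ :+ con 0ℚ) :* e
      in ((:- e) :+ (:- e)) :* (k :* (d :* a :- c :* b))
           := k :* ((re-γ :* b :+ im-γ :* a) :* c :- (re-γ :* a :- im-γ :* b) :* d)) ≡.refl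
    (seq κ n) (seq β n) (seq (re Y) n) (seq (im Y) n) (seq (re Z) n) (seq (im Z) n)

  form-neg : ∀ κ X Z → ⊟ form κ X Z ≈ᵣ form κ (-ᶜ X) Z
  form-neg κ X Z = pointwise λ n → solve 5 (λ k a b c d →
      :- (k :* (b :* c :- a :* d)) := k :* ((:- b) :* c :- (:- a) :* d)) ≡.refl
    (seq κ n) (seq (re X) n) (seq (im X) n) (seq (re Z) n) (seq (im Z) n)

  BA-AB≈0 : ∀ A B → B *ᶜ A +ᶜ (-ᶜ A) *ᶜ B ≈ 0ᶜ
  BA-AB≈0 A B =
      pointwise (λ n → solve 4 (λ a b c d → (c :* a :- d :* b) :+ ((:- a) :* c :- (:- b) :* d) := con 0ℚ) ≡.refl
        (seq (re A) n) (seq (im A) n) (seq (re B) n) (seq (im B) n))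
    , pointwise (λ n → solve 4 (λ a b c d → (c :* b :+ d :* a) :+ ((:- a) :* d :+ (:- b) :* c) := con 0ℚ) ≡.refl
        (seq (re A) n) (seq (im A) n) (seq (re B) n) (seq (im B) n))

⊞-≈0ʳ : ∀ {x y} → y ≈ᵣ 0ᵣ → x ⊞ y ≈ᵣ x
⊞-≈0ʳ {x} y≈0 = ≈ᵣ-trans (⊞-cong ≈ᵣ-refl y≈0) (⊞-identityʳ x)

⊠-≈0ʳ : ∀ {x y} → y ≈ᵣ 0ᵣ → x ⊠ y ≈ᵣ 0ᵣ
⊠-≈0ʳ {x} y≈0 = ≈ᵣ-trans (⊠-cong ≈ᵣ-refl y≈0) (⊠-zeroʳ x)

form-cong : ∀ κ {X X' Z Z'} → X ≈ X' → Z ≈ Z' → form κ X Z ≈ᵣ form κ X' Z'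
form-cong κ (p , q) (p' , q') = ⊠-cong ≈ᵣ-refl (⊞-cong (⊠-cong q p') (⊟-cong (⊠-cong p q')))

NonNeg-resp : ∀ {x y} → x ≈ᵣ y → NonNeg x → NonNeg y
NonNeg-resp x≈y (inj₁ p)   = inj₁ (Pos-resp x≈y p)
NonNeg-resp x≈y (inj₂ x≈0) = inj₂ (≈ᵣ-trans (≈ᵣ-sym x≈y) x≈0)

Pos-⊞-NonNeg : ∀ {x y} → Pos x → NonNeg y → Pos (x ⊞ y)
Pos-⊞-NonNeg px (inj₁ py)  = Pos-⊞ px py
Pos-⊞-NonNeg px (inj₂ y≈0) = Pos-resp (≈ᵣ-sym (⊞-≈0ʳ y≈0)) px

NonNeg-⊞ : ∀ {x y} → NonNeg x → NonNeg y → NonNeg (x ⊞ y)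
NonNeg-⊞ (inj₁ px)  hy = inj₁ (Pos-⊞-NonNeg px hy)
NonNeg-⊞ {x} {y} (inj₂ x≈0) hy = NonNeg-resp (≈ᵣ-sym (≈ᵣ-trans (⊞-comm x y) (⊞-≈0ʳ x≈0))) hy

NonNeg-⊠ : ∀ {x y} → NonNeg x → NonNeg y → NonNeg (x ⊠ y)
NonNeg-⊠ (inj₁ px)  (inj₁ py)  = inj₁ (Pos-⊠ px py)
NonNeg-⊠ (inj₁ _)   (inj₂ y≈0) = inj₂ (⊠-≈0ʳ y≈0)
NonNeg-⊠ {x} {y} (inj₂ x≈0) _  = inj₂ (≈ᵣ-trans (⊠-comm x y) (⊠-≈0ʳ x≈0))

module _ (em : ExcludedMiddle 0ℓ) where

  Pos-square : ∀ x → ¬ x ≈ᵣ 0ᵣ → Pos (x ⊠ x)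
  Pos-square x x≉0 with trichotomy em x
  ... | inj₁ px         = Pos-⊠ px px
  ... | inj₂ (inj₁ x≈0) = ⊥-elim (x≉0 x≈0)
  ... | inj₂ (inj₂ nx)  = Pos-resp (⊟x⊠⊟x≈x⊠x x) (Pos-⊠ nx nx)

  NonNeg-square : ∀ x → NonNeg (x ⊠ x)
  NonNeg-square x with em {P = x ≈ᵣ 0ᵣ}
  ... | yes x≈0 = inj₂ (⊠-≈0ʳ x≈0)
  ... | no x≉0  = inj₁ (Pos-square x x≉0)

  ⊠-≉0 : ∀ {x y} → ¬ x ≈ᵣ 0ᵣ → ¬ y ≈ᵣ 0ᵣ → ¬ x ⊠ y ≈ᵣ 0ᵣ
  ⊠-≉0 {x} {y} x≉0 y≉0 xy≈0 = Pos⇒≉0 (Pos-⊠ (Pos-square x x≉0) (Pos-square y y≉0))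
    (≈ᵣ-trans (⊠-square x y) (⊠-≈0ʳ xy≈0))

  NonNeg-normSq : ∀ z → NonNeg (normSq z)
  NonNeg-normSq z = NonNeg-⊞ (NonNeg-square (re z)) (NonNeg-square (im z))

  Pos-normSq : ∀ z → ¬ z ≈ 0ᶜ → Pos (normSq z)
  Pos-normSq z z≉0 with em {P = re z ≈ᵣ 0ᵣ}
  ... | no re≉0  = Pos-⊞-NonNeg (Pos-square (re z) re≉0) (NonNeg-square (im z))
  ... | yes re≈0 = Pos-resp (⊞-comm _ _)
    (Pos-⊞-NonNeg (Pos-square (im z) λ im≈0 → z≉0 (re≈0 , im≈0)) (NonNeg-square (re z)))

  *-≉0 : ∀ {z w} → ¬ z ≈ 0ᶜ → ¬ w ≈ 0ᶜ → ¬ z *ᶜ w ≈ 0ᶜ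
  *-≉0 {z} {w} z≉0 w≉0 (re≈0 , im≈0) = Pos⇒≉0 (Pos-⊠ (Pos-normSq z z≉0) (Pos-normSq w w≉0))
    (≈ᵣ-trans (normSq-* z w) (≈ᵣ-trans (⊞-≈0ʳ (⊠-≈0ʳ im≈0)) (⊠-≈0ʳ re≈0)))

  -- If the form is not positive at A, it is nonnegative at A' = -A.
  ▶-or-opposite : ∀ κ A B →
    Pos (form κ A B) ⊎ ∃ λ A' → NonNeg (form κ A' B) × B *ᶜ A +ᶜ A' *ᶜ B ≈ 0ᶜ
  ▶-or-opposite κ A B with trichotomy em (form κ A B)
  ... | inj₁ p          = inj₁ p
  ... | inj₂ (inj₁ f≈0) =
    inj₂ (-ᶜ A , inj₂ (≈ᵣ-trans (≈ᵣ-sym (form-neg κ A B)) (≈ᵣ-trans (⊟-cong f≈0) ⊟0≈0)) , BA-AB≈0 A B)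
  ... | inj₂ (inj₂ n)   = inj₂ (-ᶜ A , inj₁ (Pos-resp (form-neg κ A B) n) , BA-AB≈0 A B)

  stabilityForm : ∀ w α β → ¬ im w ≈ᵣ 0ᵣ → Pos (⊟ β) → StabilityForm w (fromℝ α) ((1ᶜ +ᶜ 1ᶜ) *ᶜ fromℝ β)
  stabilityForm w α β im≉0 β<0 = record
    { _▷_       = λ X Z → NonNeg (form κ X Z)
    ; _▶_       = λ X Z → Pos (form κ X Z)
    ; ▷-resp    = λ p q → NonNeg-resp (form-cong κ p q)
    ; ▶-respˡ   = λ p → Pos-resp (form-cong κ p (≈ᵣ-refl , ≈ᵣ-refl))
    ; 0▷        = λ Z → inj₂ (form-0ˡ κ Z)
    ; ▷0        = λ X → inj₂ (form-0ʳ κ X)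
    ; ▷-+ˡ      = λ {X} {Y} {Z} p q → NonNeg-resp (form-+ˡ κ X Y Z) (NonNeg-⊞ p q)
    ; ▷-+ʳ      = λ {X} {Y} {Z} p q → NonNeg-resp (form-+ʳ κ X Y Z) (NonNeg-⊞ p q)
    ; ▷-scale   = λ t {X} {Z} p → NonNeg-resp (form-scale κ t X Z) (NonNeg-⊠ (NonNeg-normSq t) p)
    ; ▶⇒▷       = inj₁
    ; ▶-+▷      = λ {X} {Y} {Z} p q → Pos-resp (form-+ˡ κ X Y Z) (Pos-⊞-NonNeg p q)
    ; ▶⇒≉0      = λ {X} {Z} p X≈0 → Pos⇒≉0 p (≈ᵣ-trans (form-cong κ X≈0 (≈ᵣ-refl , ≈ᵣ-refl)) (form-0ˡ κ Z))
    ; w▶        = λ {Z} Z≉0 → Pos-resp (form-im w Z) (Pos-⊠ (Pos-square κ im≉0) (Pos-normSq Z Z≉0))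
    ; α▷        = λ Z → inj₂ (form-real κ α Z)
    ; γ▷        = λ {Y} {Z} p → NonNeg-resp (form-swap κ β Y Z) (NonNeg-⊠ (inj₁ (Pos-⊞ β<0 β<0)) p)
    ; ▶-or-zero = ▶-or-opposite κ
    ; domain    = *-≉0
    ; ν≉0       = λ n ν≈0 → Pos⇒≉0 (Pos-re-ν n) (proj₁ ν≈0)
    ; ≈0?       = λ X → em
    }
    where κ = im w

-- From the stability form to the zeros of Pₘ

opaque
  unfolding _⊞_ _⊠_ ⊟_

  -- Im((c s)²) = 2c² Re s Im s. The factor 2 is `re (ν 2)` because `Pos-re-ν` shows it to be
  -- positive.
  im-x² : ∀ c s → re (ν 2) ⊠ ((c ⊠ c) ⊠ (re s ⊠ im s)) ≈ᵣ im ((fromℝ c *ᶜ s) *ᶜ (fromℝ c *ᶜ s))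
  im-x² c s = pointwise λ n → solve 3 (λ c a b →
      let re-x = c :* a :- con 0ℚ :* b
          im-x = c :* b :+ con 0ℚ :* a
      in (con 1ℚ :+ (con 1ℚ :+ con 0ℚ)) :* ((c :* c) :* (a :* b)) := re-x :* im-x :+ im-x :* re-x) ≡.refl
    (seq c n) (seq (re s) n) (seq (im s) n)

-- Propositional equality rather than `≈` lets whole sums be rewritten by congruence.
+≡+ᶜ : ∀ z w → z + w ≡ z +ᶜ w
+≡+ᶜ z w = ≡.cong₂ _+i_ (+ᵣ≡⊞ (re z) (re w)) (+ᵣ≡⊞ (im z) (im w))

*≡*ᶜ : ∀ z w → z * w ≡ z *ᶜ w
*≡*ᶜ z w = ≡.cong₂ _+i_
  (≡.trans (+ᵣ≡⊞ (re z *ᵣ re w) (-ᵣ (im z *ᵣ im w)))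
    (≡.cong₂ _⊞_ (*ᵣ≡⊠ (re z) (re w)) (≡.trans (-ᵣ≡⊟ (im z *ᵣ im w)) (≡.cong ⊟_ (*ᵣ≡⊠ (im z) (im w))))))
  (≡.trans (+ᵣ≡⊞ (re z *ᵣ im w) (im z *ᵣ re w)) (≡.cong₂ _⊞_ (*ᵣ≡⊠ (re z) (im w)) (*ᵣ≡⊠ (im z) (re w))))

<0⇒Pos-⊟ : ∀ {x} → x <ᵣ 0ᵣ → Pos (⊟ x)
<0⇒Pos-⊟ {x} (ε , 0<ε , N , x+ε<0) = ≡.subst Pos (-ᵣ≡⊟ x) (mkPos (ε , 0<ε , N , λ n N≤n →
  ≡.subst₂ ℚ._<_ (cancel (seq x n) ε) (ℚₚ.+-identityˡ (ℚ.- seq x n)) (ℚₚ.+-monoˡ-< (ℚ.- seq x n) (x+ε<0 n N≤n))))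
  where
  cancel : ∀ p q → (p ℚ.+ q) ℚ.- p ≡ q
  cancel = solve 2 (λ p q → (p :+ q) :- p := q) ≡.refl

/!≡*1/! : ∀ z n → z /! n ≡ z *ᶜ 1/! n
/!≡*1/! z n = *≡*ᶜ z (fromℝ (fromℚ ((+ 1 / (n !)) {{n ℕₚ.!≢0}})))

/!-≈0 : ∀ z y n → z /! n ≈ y → z ≈ 0ᶜ → y ≈ 0ᶜ
/!-≈0 z y n z/n!≈y z≈0 = trans {y} {z *ᶜ 1/! n} {0ᶜ}
  (sym {z *ᶜ 1/! n} {y} (≡.subst (_≈ y) (/!≡*1/! z n) z/n!≈y))
  (trans {z *ᶜ 1/! n} {0ᶜ *ᶜ 1/! n} {0ᶜ} (*-congʳ {1/! n} {z} {0ᶜ} z≈0) (zeroˡ (1/! n)))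

∑≤≡∑ : ∀ n {a b : ℕ → ℂ} → (∀ i → a i ≡ b i) → ∑≤ n a ≡ ∑ n b
∑≤≡∑ zero    e = e 0
∑≤≡∑ (suc n) e = ≡.trans (+≡+ᶜ _ _) (≡.cong₂ _+ᶜ_ (∑≤≡∑ n e) (e (suc n)))

module _ (α β : ℝ) (x : ℂ) (f : PowerSeries) (f₀ : f 0 ≈ 0ᶜ) (f₁ : f 1 ≈ x) (f₂ : f 2 ≈ fromℝ α)
  (f₃ : f 3 ≈ 0ᶜ) (f₄ : f 4 ≈ fromℝ β) (f₅ : ∀ i → f (5 ℕ.+ i) ≈ 0ᶜ) where

  f*ₛ : ∀ g n → (f *ₛ g) n ≈ Multiplication.mul x (fromℝ α) (fromℝ β) g n
  f*ₛ g n = ≡.subst (_≈ Multiplication.mul x (fromℝ α) (fromℝ β) g n)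
    (≡.sym (∑≤≡∑ n λ i → *≡*ᶜ (f i) (g (n ℕ.∸ i)))) (convolution f g f₀ f₁ f₂ f₃ f₄ f₅ n)

  open Exponential x (fromℝ α) (fromℝ β)

  ^ₛ-suc : ∀ k n → (f ^ₛ suc k) n ≈ Multiplication.mul x (fromℝ α) (fromℝ β) (f ^ₛ k) n
  ^ₛ-suc k = f*ₛ (f ^ₛ k)

  1/!0≈1 : 1/! 0 ≈ 1ᶜ
  1/!0≈1 = refl {1ᶜ}

  expₛ≡partialExp : ∀ K n → ∑≤ K (λ k → (f ^ₛ k) n /! k) ≡ partialExp (f ^ₛ_) 1/! (refl {1ᶜ}) (λ _ → refl {0ᶜ}) ^ₛ-suc 1/!0≈1 ν*1/! K n
  expₛ≡partialExp zero    n = /!≡*1/! ((f ^ₛ 0) n) 0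
  expₛ≡partialExp (suc K) n = ≡.trans
    (+≡+ᶜ (∑≤ K (λ k → (f ^ₛ k) n /! k)) ((f ^ₛ suc K) n /! suc K))
    (≡.cong₂ _+ᶜ_ (expₛ≡partialExp K n) (/!≡*1/! ((f ^ₛ suc K) n) (suc K)))

  expₛ≉0 : ExcludedMiddle 0ℓ → β <ᵣ 0ᵣ → ¬ im (x *ᶜ x) ≈ᵣ 0ᵣ → ∀ m → ¬ expₛ f m ≈ 0ᶜ
  expₛ≉0 em β<0 im≉0 m e≈0 = exp≉0 (f ^ₛ_) 1/! (refl {1ᶜ}) (λ _ → refl {0ᶜ}) ^ₛ-suc 1/!0≈1 ν*1/!
    (stabilityForm em (x *ᶜ x) α β im≉0 (<0⇒Pos-⊟ β<0)) m
    (≡.subst (_≈ 0ᶜ) (expₛ≡partialExp m m) e≈0)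

theorem1 : ExcludedMiddle 0ℓ →
    (α β c : ℝ) → β <ᵣ 0ᵣ → ¬ (c ≈ᵣ 0ᵣ) →
    (P : ℕ → Polynomial) → GeneratedBy α β c P →
    (m : ℕ) (s : ℂ) → eval (P m) s ≈ 0ᶜ →
    IsReal s ⊎ IsPurelyImaginary s
theorem1 em α β c β<0 c≉0 P gen m s P≈0 = by-cases em em
  where
  expₛ≈0 : expₛ (exponent α β c s) m ≈ 0ᶜ
  expₛ≈0 = /!-≈0 (eval (P m) s) (expₛ (exponent α β c s) m) m (gen s m) P≈0

  by-cases : Dec (IsReal s) → Dec (IsPurelyImaginary s) → IsReal s ⊎ IsPurelyImaginary s
  by-cases (yes im≈0) _          = inj₁ im≈0
  by-cases (no _)     (yes re≈0) = inj₂ re≈0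
  by-cases (no im≉0)  (no re≉0)  = ⊥-elim (expₛ≉0 α β (fromℝ c *ᶜ s) (exponent α β c s)
      (refl {0ᶜ}) (reflexive (*≡*ᶜ (fromℝ c) s)) (refl {fromℝ α}) (refl {0ᶜ}) (refl {fromℝ β}) (λ _ → refl {0ᶜ})
      em β<0 im-x²≉0 m expₛ≈0)
    where
    im-x²≉0 : ¬ im ((fromℝ c *ᶜ s) *ᶜ (fromℝ c *ᶜ s)) ≈ᵣ 0ᵣ
    -- In 2c² Re s Im s, every factor is nonzero: c by hypothesis, the two parts of s by the case at
    -- hand.
    im-x²≉0 h = ⊠-≉0 em (Pos⇒≉0 (Pos-re-ν 1)) (⊠-≉0 em (⊠-≉0 em c≉0 c≉0) (⊠-≉0 em re≉0 im≉0)) (≈ᵣ-trans (im-x² c s) h)
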